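{- Let $r,k$ be integers with $r\ge 2$ and $0\le k\le r-1$, and let $H$ be an $r$-graph consisting of exactly two edges which intersect in exactly $k$ vertices. If $n\ge 2r-k$, then $$\phi_H^r(n)=\left\lceil \tfrac12\binom{n}{r}\right\rceil.$$ Moreover, every $r$-graph $G\in\mathcal{K}^r_{n,2}$ is an extremal graph of $H$, and if $\binom{n}{r}\equiv 0\pmod 2$ then $K_n^r$ is also an extremal graph of $H$.
   Context: An $r$-graph is an $r$-uniform hypergraph. For $r$-graphs $G$ and $H$, an $H$-decomposition of $G$ is a partition of the edge set $E(G)$ into parts such that each part is either a single edge or its edges form an $r$-graph isomorphic to $H$. $\phi_H^r(G)$ is the minimum number of parts in an $H$-decomposition of $G$, and $\phi_H^r(n)=\max\{\phi_H^r(G): G \text{ an } r\text{ -graph on } n \text{ vertices}\}$. An $r$-graph $G$ on $n$ vertices with $\phi_H^r(G)=\phi_H^r(n)$ is called an extremal graph of $H$. $K_n^r$ denotes the complete $r$-graph on $n$ vertices. For positive integers $n\ge r$ and $k$, let $\ell$ be the unique integer with $0\le \ell\le k-1$ such that $\binom{n}{r}-\ell\equiv k-1\pmod k$; $\mathcal{K}^r_{n,k}$ denotes the family of all $r$-graphs obtained from $K_n^r$ by deleting $\ell$ edges. -}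

module Defs where

open import Data.Nat using (ℕ; _+_; _≤_; _<_; _∸_; _%_; NonZero)
open import Data.Nat.Combinatorics using (_C_)
open import Data.Fin using (Fin)
open import Data.Fin.Subset using (Subset; ∣_∣) renaming (_∈_ to _∈ₛ_)
open import Data.List using (List; []; _∷_; concat; length)
open import Data.List.Membership.Propositional using () renaming (_∈_ to _∈ₗ_)
open import Data.List.Relation.Unary.All using (All)
open import Data.List.Relation.Unary.Unique.Propositional using (Unique)
open import Data.List.Relation.Binary.Permutation.Propositional using (_↭_)
open import Data.Product using (Σ; ∃; _×_)
open import Data.Sum using (_⊎_)
open import Function.Bundles using (_⇔_)
open import Function.Definitions using (Injective)
open import Relation.Binary.PropositionalEquality using (_≡_)

record RGraph (r n : ℕ) : Set where
  field
    edges   : List (Subset n)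
    unique  : Unique edges
    uniform : All (λ e → ∣ e ∣ ≡ r) edges
open RGraph public

IsImage : {m n : ℕ} → (Fin m → Fin n) → Subset m → Subset n → Set
IsImage {m} f h e = ∀ (y : Fin _) → (y ∈ₛ e) ⇔ (∃ λ (x : Fin m) → (x ∈ₛ h) × (f x ≡ y))

-- The edges in the list P form an r-graph isomorphic to H
-- (H is assumed to have no isolated vertices; then this says exactly that
--  some injective vertex map carries the edge set of H onto the set P).
IsCopy : {r m n : ℕ} → RGraph r m → List (Subset n) → Set
IsCopy {r} {m} {n} H P =
  Σ (Fin m → Fin n) λ f → Injective _≡_ _≡_ f ×
    (∀ (e : Subset n) → (e ∈ₗ P) ⇔ (∃ λ h → (h ∈ₗ edges H) × IsImage f h e))

IsPart : {r m n : ℕ} → RGraph r m → List (Subset n) → Set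
IsPart H P = (∃ λ e → P ≡ e ∷ []) ⊎ IsCopy H P

record Decomposition {r m n : ℕ} (H : RGraph r m) (G : RGraph r n) : Set where
  field
    parts     : List (List (Subset n))
    partition : concat parts ↭ edges G
    allParts  : All (IsPart H) parts
open Decomposition public

IsPhi : {r m n : ℕ} → RGraph r m → RGraph r n → ℕ → Set
IsPhi H G t =
  (Σ (Decomposition H G) λ D → length (parts D) ≡ t) ×
  (∀ (D : Decomposition H G) → t ≤ length (parts D))

IsPhiN : {r m : ℕ} → RGraph r m → ℕ → ℕ → Set
IsPhiN {r} H n t =
  (Σ (RGraph r n) λ G → IsPhi H G t) ×
  (∀ (G : RGraph r n) (s : ℕ) → IsPhi H G s → s ≤ t)

Extremal : {r m n : ℕ} → RGraph r m → RGraph r n → Set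
Extremal {n = n} H G = Σ ℕ λ t → IsPhiN H n t × IsPhi H G t

IsComplete : {r n : ℕ} → RGraph r n → Set
IsComplete {r} G = ∀ e → ∣ e ∣ ≡ r → e ∈ₗ edges G

-- G ∈ 𝒦^r_{n,k}: G is obtained from K_n^r by deleting ℓ edges, where
-- 0 ≤ ℓ ≤ k-1 and C(n,r) - ℓ ≡ k-1 (mod k)  (i.e. C(n,r) ≡ ℓ + (k-1) mod k).
InK : {r n : ℕ} (k : ℕ) .{{_ : NonZero k}} → RGraph r n → Set
InK {r} {n} k G = Σ ℕ λ ℓ → (ℓ < k) × ((n C r) % k ≡ (ℓ + (k ∸ 1)) % k) ×
  (length (edges G) + ℓ ≡ n C r)

{-# OPTIONS --safe #-}

-- The r-subsets of an n-set, adjacent when they meet in exactly k points, form a graph which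
-- is vertex-transitive and, unless k = 0 and n = 2r, connected: two r-subsets differing by one
-- swap have a common neighbour. A finite connected vertex-transitive graph has a matching
-- missing at most one vertex (Gallai's lemma), and for k = 0 and n = 2r complementation is a
-- perfect matching. Such a matching splits K_n^r into ⌈C(n,r)/2⌉ parts, and intersecting these
-- parts with E(G) gives a decomposition of any r-graph G into at most as many parts.
-- Conversely parts have at most two edges, so φ(G) ≥ ⌈|E(G)|/2⌉.
module Submission where

open import Defs
open import Data.Bool using (Bool; true; false; if_then_else_)
import Data.Bool.Properties as Bool
open import Data.Fin using (Fin; zero; suc; toℕ; punchIn; punchOut)
open import Data.Fin.Properties as Fin
  using (pigeonhole; punchIn-injective; punchInᵢ≢i; punchIn-punchOut)
open import Data.Fin.Subset using (Subset; ∣_∣; _∩_; _∈_; ∁; ⊥; inside; outside)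
open import Data.Fin.Subset.Properties
  using (∣p∣≤n; ∩-idem; ∩-comm; ∩-inverseʳ; ∣⊥∣≡0; ∣∁p∣≡n∸∣p∣; ⊆-antisym)
open import Data.List
  using (List; []; _∷_; _++_; map; concat; filter; length) renaming (lookup to lookupₗ)
open import Data.List.Properties
  using (map-∘; map-cong; length-map; length-++; concat-map; filter-++)
import Data.List.Membership.DecPropositional as DecMembership
open import Data.List.Membership.Propositional using () renaming (_∈_ to _∈ₗ_)
open import Data.List.Membership.Propositional.Properties
  using (∈-map⁺; ∈-map⁻; ∈-++⁺ˡ; ∈-++⁺ʳ; ∈-∃++; ∈-filter⁺; ∈-filter⁻)
open import Data.List.Membership.Propositional.Properties.WithK using (unique∧set⇒bag)
open import Data.List.Relation.Binary.BagAndSetEquality using (∼bag⇒↭)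
open import Data.List.Relation.Binary.Permutation.Propositional
  using (_↭_; ↭-refl; ↭-sym; ↭-trans; ↭-prep; ↭⇒↭ₛ)
import Data.List.Relation.Binary.Permutation.Propositional.Properties as Perm
import Data.List.Relation.Binary.Permutation.Setoid.Properties as PermSetoid
open import Data.List.Relation.Unary.All as All using (All; []; _∷_)
import Data.List.Relation.Unary.All.Properties as All
open import Data.List.Relation.Unary.AllPairs as AllPairs using ([]; _∷_)
open import Data.List.Relation.Unary.Any as Any using (here; there)
open import Data.List.Relation.Unary.Any.Properties using (lookup-index)
open import Data.List.Relation.Unary.Unique.Propositional using (Unique)
import Data.List.Relation.Unary.Unique.Propositional.Properties as Uniq
open import Data.Nat
  using (ℕ; zero; suc; _+_; _*_; _∸_; _%_; _≤_; _<_; z≤n; s≤s; ⌈_/2⌉; ⌊_/2⌋)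
open import Data.Nat.Combinatorics
  using (_C_; nCn≡1; nCk≡nC[n∸k]; k>n⇒nCk≡0; nCk+nC[k+1]≡[n+1]C[k+1])
open import Data.Nat.GeneralisedArithmetic using (fold; fold-+)
open import Data.Nat.ListAction using (sum)
open import Data.Nat.ListAction.Properties using (sum-↭)
open import Data.Nat.Properties as ℕₚ using (module ≤-Reasoning)
open import Data.Nat.Tactic.RingSolver using (solve-∀)
open import Algebra.Properties.CommutativeSemigroup ℕₚ.+-commutativeSemigroup using (interchange)
open import Data.Product using (Σ; ∃; _×_; _,_; proj₁; proj₂)
import Data.Product.Properties as Product
open import Data.Sum using (_⊎_; inj₁; inj₂)
open import Data.Vec using (Vec; []; _∷_; zip; lookup; count; removeAt)
open import Data.Vec.Properties using (∷-injectiveʳ; lookup-zip; []=⇒lookup; lookup⇒[]=; ≡-dec)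
open import Function using (_∘_; id; _on_; mk⇔)
open import Function.Bundles using (module Equivalence)
open import Function.Definitions using (Injective)
open import Relation.Nullary using (¬_; Dec; yes; no; does; contradiction)
open import Relation.Nullary.Decidable using (map′; toSum; dec-true; dec-false)
open import Relation.Binary.Definitions using (DecidableEquality; Tri; tri<; tri≈; tri>)
open import Relation.Binary.Construct.Closure.ReflexiveTransitive using (Star; ε; _◅_; _◅◅_)
open import Relation.Binary.Construct.Closure.Symmetric using (fwd; bwd)
open import Relation.Binary.Construct.Closure.Equivalence as Eq using (EqClosure)
open import Relation.Binary.PropositionalEquality
  using (_≡_; _≢_; refl; sym; trans; cong; cong₂; subst; setoid; module ≡-Reasoning)

-- Components of a union of two matchings are paths and cycles. Encoding a matching as an involution
-- that fixes the exposed vertices turns such a component into an orbit of the dihedral group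
-- generated by two involutions. That a path starting at an end has only one other end then becomes
-- a statement about the order of a rotation. No maximum matching is ever chosen: Gallai's argument
-- is stated for matchings exposing a given number of vertices and concludes that some matching
-- exposes fewer, so a descent on that number suffices.

-- Iterates of an injective map and dihedral orbits.

fold-comm : {A : Set} (z : A) (s : A → A) (n : ℕ) → fold (s z) s n ≡ s (fold z s n)
fold-comm z s zero    = refl
fold-comm z s (suc n) = cong s (fold-comm z s n)

fold-injective : {A : Set} {s : A → A} → (∀ {x y} → s x ≡ s y → x ≡ y) →
  ∀ {x y} n → fold x s n ≡ fold y s n → x ≡ y
fold-injective inj zero    eq = eq
fold-injective inj (suc n) eq = fold-injective inj n (inj eq)

-- The orbit of x under the dihedral group generated by two involutions μ and ν, where ν
-- fixes x, consists of the iterates of x under the rotation μ ∘ ν.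
module Dihedral {A : Set} (_≟_ : DecidableEquality A)
  (μ ν : A → A) (μμ : ∀ y → μ (μ y) ≡ y) (νν : ∀ y → ν (ν y) ≡ y)
  (x : A) (νx : ν x ≡ x) where

  π : A → A
  π y = μ (ν y)

  iterate : ℕ → A
  iterate = fold x π

  π-injective : ∀ {y z} → π y ≡ π z → y ≡ z
  π-injective {y} {z} eq = begin
    y               ≡⟨ νν y ⟨
    ν (ν y)         ≡⟨ cong ν (μμ (ν y)) ⟨
    ν (μ (π y))     ≡⟨ cong (ν ∘ μ) eq ⟩
    ν (μ (π z))     ≡⟨ cong ν (μμ (ν z)) ⟩
    ν (ν z)         ≡⟨ νν z ⟩
    z               ∎
    where open ≡-Reasoning

  -- The dihedral relation: conjugation by `ν` inverts the rotation, written without an inverse of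
  -- `π`.
  πνπ : ∀ y → π (ν (π y)) ≡ ν y
  πνπ y = trans (cong μ (νν (π y))) (μμ (ν y))

  -- Since `ν` inverts `π` and fixes `x`, it sends the iterate of index j to that of index -j, and j
  -- further rotations return to `x`.
  reflect : ∀ j → fold (ν (iterate j)) π j ≡ x
  reflect zero    = νx
  reflect (suc j) = begin
    π (fold (ν (π (iterate j))) π j)  ≡⟨ fold-comm _ π j ⟨
    fold (π (ν (π (iterate j)))) π j  ≡⟨ cong (λ y → fold y π j) (πνπ (iterate j)) ⟩
    fold (ν (iterate j)) π j          ≡⟨ reflect j ⟩
    x                                 ∎
    where open ≡-Reasoning

  -- As `μ` equals `π ∘ ν`, it sends index i to 1 - i. A fixed point there makes 2i - 1 a period;
  -- this form avoids the subtraction.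
  μ-fixed⇒period : ∀ i → μ (iterate i) ≡ iterate i → iterate (i + i) ≡ π x
  μ-fixed⇒period i fixed = begin
    iterate (i + i)                 ≡⟨ fold-+ x π i ⟩
    fold (iterate i) π i            ≡⟨ cong (λ y → fold y π i) fixed ⟨
    fold (μ (iterate i)) π i        ≡⟨ cong (λ y → fold (μ y) π i) (νν (iterate i)) ⟨
    fold (π (ν (iterate i))) π i    ≡⟨ fold-comm _ π i ⟩
    π (fold (ν (iterate i)) π i)    ≡⟨ cong π (reflect i) ⟩
    π x                             ∎
    where open ≡-Reasoning

  iterate-* : ∀ {a} → iterate a ≡ x → ∀ t → iterate (t * a) ≡ x
  iterate-* {a} eq zero    = refl
  iterate-* {a} eq (suc t) = begin
    iterate (a + t * a)            ≡⟨ fold-+ x π a ⟩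
    fold (iterate (t * a)) π a     ≡⟨ cong (λ y → fold y π a) (iterate-* eq t) ⟩
    iterate a                      ≡⟨ eq ⟩
    x                              ∎
    where open ≡-Reasoning

  private
    -- The order of the rotation at x divides both 2j - 1 and 2t, hence t.
    μ-fixed-shift : ∀ j t → μ (iterate (j + t)) ≡ iterate (j + t) →
      μ (iterate j) ≡ iterate j → iterate (j + t) ≡ iterate j
    μ-fixed-shift j t fixedⱼₜ fixedⱼ = begin
      iterate (j + t)       ≡⟨ fold-+ x π j ⟩
      fold (iterate t) π j  ≡⟨ cong (λ y → fold y π j) iterate-t ⟩
      iterate j             ∎
      where
      open ≡-Reasoning

      double-+ : ∀ a b → (a + a) + (b + b) ≡ (a + b) + (a + b)
      double-+ = solve-∀

      *-double : ∀ a b → a * (b + b) ≡ b * (a + a)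
      *-double = solve-∀

      -- The periods 2j - 1 and 2(j + t) - 1 differ by 2t.
      period-2t : iterate (t + t) ≡ x
      period-2t = fold-injective π-injective (j + j) (begin
        fold (iterate (t + t)) π (j + j)  ≡⟨ fold-+ x π (j + j) ⟨
        iterate ((j + j) + (t + t))       ≡⟨ cong iterate (double-+ j t) ⟩
        iterate ((j + t) + (j + t))       ≡⟨ μ-fixed⇒period (j + t) fixedⱼₜ ⟩
        π x                               ≡⟨ μ-fixed⇒period j fixedⱼ ⟨
        iterate (j + j)                   ∎)

      -- At `x`, 2j rotations amount to a single one. So t rotations amount to 2jt, which is j times
      -- the period 2t; no division by 2 occurs.
      iterate-multiple : ∀ s → iterate (s * (j + j)) ≡ iterate s
      iterate-multiple zero    = refl
      iterate-multiple (suc s) = begin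
        iterate (j + j + s * (j + j))           ≡⟨ cong iterate (ℕₚ.+-comm (j + j) _) ⟩
        iterate (s * (j + j) + (j + j))         ≡⟨ fold-+ x π (s * (j + j)) ⟩
        fold (iterate (j + j)) π (s * (j + j))  ≡⟨ cong (λ y → fold y π (s * (j + j)))
                                                        (μ-fixed⇒period j fixedⱼ) ⟩
        fold (π x) π (s * (j + j))              ≡⟨ fold-comm x π (s * (j + j)) ⟩
        π (iterate (s * (j + j)))               ≡⟨ cong π (iterate-multiple s) ⟩
        iterate (suc s)                         ∎

      iterate-t : iterate t ≡ x
      iterate-t = begin
        iterate t              ≡⟨ iterate-multiple t ⟨
        iterate (t * (j + j))  ≡⟨ cong iterate (*-double t j) ⟩
        iterate (j * (t + t))  ≡⟨ iterate-* period-2t j ⟩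
        x                      ∎

  μ-fixed-unique : ∀ i j → μ (iterate i) ≡ iterate i → μ (iterate j) ≡ iterate j →
    iterate i ≡ iterate j
  μ-fixed-unique i j fixedᵢ fixedⱼ with ℕₚ.≤-total j i
  ... | inj₁ j≤i with t , refl ← ℕₚ.m≤n⇒∃[o]m+o≡n j≤i = μ-fixed-shift j t fixedᵢ fixedⱼ
  ... | inj₂ i≤j with t , refl ← ℕₚ.m≤n⇒∃[o]m+o≡n i≤j = sym (μ-fixed-shift i t fixedⱼ fixedᵢ)

  module _ {p} (period : iterate (suc p) ≡ x) where

    -- Bounding the exponent by a period makes membership decidable, as splicing two matchings along
    -- the orbit requires.
    Orbit : A → Set
    Orbit y = ∃ λ j → j < suc p × iterate j ≡ y

    Orbit? : ∀ y → Dec (Orbit y)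
    Orbit? y = ℕₚ.anyUpTo? (λ j → iterate j ≟ y) (suc p)

    base∈Orbit : Orbit x
    base∈Orbit = 0 , s≤s z≤n , refl

    π-Orbit : ∀ {y} → Orbit y → Orbit (π y)
    π-Orbit (j , s≤s j≤p , refl) with ℕₚ.m≤n⇒m<n∨m≡n j≤p
    ... | inj₁ j<p  = suc j , s≤s j<p , refl
    ... | inj₂ refl = 0 , s≤s z≤n , sym period

    -- By `πνπ`, each further rotation before `ν` moves the reflected index one step back; from 0 it
    -- wraps around to `p`.
    ν-iterate : ∀ j → Orbit (ν (iterate j))
    ν-iterate zero = subst Orbit (sym νx) base∈Orbit
    ν-iterate (suc j) with ν-iterate j
    ... | suc i , i<p , eq = i , ℕₚ.m<n⇒m<1+n (ℕₚ.≤-pred i<p) ,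
                             π-injective (trans eq (sym (πνπ (iterate j))))
    ... | zero  , _   , eq = p , ℕₚ.≤-refl ,
                             π-injective (trans period (trans eq (sym (πνπ (iterate j)))))

    ν-Orbit : ∀ {y} → Orbit y → Orbit (ν y)
    ν-Orbit (j , _ , refl) = ν-iterate j

    μ-Orbit : ∀ {y} → Orbit y → Orbit (μ y)
    μ-Orbit {y} o = subst Orbit (cong μ (νν y)) (π-Orbit (ν-Orbit o))

    Orbit-μ-fixed-unique : ∀ {y z} → Orbit y → Orbit z → μ y ≡ y → μ z ≡ z → y ≡ z
    Orbit-μ-fixed-unique (i , _ , refl) (j , _ , refl) = μ-fixed-unique i j

-- Two of the first `suc (length xs)` iterates coincide by the pigeonhole principle; injectivity
-- cancels their common steps, so `x` itself recurs.
periodic : {A : Set} (xs : List A) → (∀ y → y ∈ₗ xs) → {s : A → A} →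
  (∀ {y z} → s y ≡ s z → y ≡ z) → ∀ x → ∃ λ p → fold x s (suc p) ≡ x
periodic xs complete {s} s-injective x
  with i , j , i<j , same ← pigeonhole (ℕₚ.n<1+n (length xs))
                              (λ i → Any.index (complete (fold x s (toℕ i))))
  with p , i+1+p≡j ← ℕₚ.m≤n⇒∃[o]m+o≡n i<j
  = p , fold-injective s-injective (toℕ i) (begin
    fold (fold x s (suc p)) s (toℕ i)                     ≡⟨ fold-+ x s (toℕ i) ⟨
    fold x s (toℕ i + suc p)                              ≡⟨ cong (fold x s)
                                                                 (trans (ℕₚ.+-suc (toℕ i) p) i+1+p≡j) ⟩
    fold x s (toℕ j)                                      ≡⟨ lookup-index (complete _) ⟩
    lookupₗ xs (Any.index (complete (fold x s (toℕ j))))   ≡⟨ cong (lookupₗ xs) same ⟨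
    lookupₗ xs (Any.index (complete (fold x s (toℕ i))))   ≡⟨ lookup-index (complete _) ⟨
    fold x s (toℕ i)                                      ∎)
  where open ≡-Reasoning

-- Counting fixed points.

unique-set⇒↭ : {A : Set} {xs ys : List A} → Unique xs → Unique ys →
  (∀ {x} → x ∈ₗ xs → x ∈ₗ ys) → (∀ {x} → x ∈ₗ ys → x ∈ₗ xs) → xs ↭ ys
unique-set⇒↭ xs! ys! xs⊆ys ys⊆xs = ∼bag⇒↭ (unique∧set⇒bag xs! ys! (mk⇔ xs⊆ys ys⊆xs))

module FixedPoints {A : Set} (_≟_ : DecidableEquality A) where

  χ : (A → A) → A → ℕ
  χ f x = if does (f x ≟ x) then 1 else 0

  fixes : (A → A) → List A → ℕ
  fixes f xs = sum (map (χ f) xs)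

  χ-fixed : ∀ {f x} → f x ≡ x → χ f x ≡ 1
  χ-fixed {f} {x} eq rewrite dec-true (f x ≟ x) eq = refl

  χ-moved : ∀ {f x} → f x ≢ x → χ f x ≡ 0
  χ-moved {f} {x} neq rewrite dec-false (f x ≟ x) neq = refl

  χ-cong : ∀ f g {x} → f x ≡ g x → χ f x ≡ χ g x
  χ-cong _ _ {x} eq = cong (λ y → if does (y ≟ x) then 1 else 0) eq

  χ-≡1⇒fixed : ∀ {f x} → χ f x ≡ 1 → f x ≡ x
  χ-≡1⇒fixed {f} {x} eq with f x ≟ x
  ... | yes fx≡x = fx≡x
  χ-≡1⇒fixed () | no _

  fixes-↭ : ∀ f {xs ys} → xs ↭ ys → fixes f xs ≡ fixes f ys
  fixes-↭ f p = sum-↭ (Perm.map⁺ (χ f) p)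

  fixes-none : ∀ {f} xs → (∀ x → f x ≢ x) → fixes f xs ≡ 0
  fixes-none []       moved = refl
  fixes-none {f} (x ∷ xs) moved = cong₂ _+_ (χ-moved {f} (moved x)) (fixes-none xs moved)

  fixes-≤ : ∀ {f g} xs → (∀ x → χ f x ≤ χ g x) → fixes f xs ≤ fixes g xs
  fixes-≤ []       f≤g = z≤n
  fixes-≤ (x ∷ xs) f≤g = ℕₚ.+-mono-≤ (f≤g x) (fixes-≤ xs f≤g)

  fixes-< : ∀ {f g xs x} → (∀ x → χ f x ≤ χ g x) → x ∈ₗ xs → χ f x < χ g x →
    fixes f xs < fixes g xs
  fixes-< {xs = _ ∷ xs} f≤g (here refl) f<g = ℕₚ.+-mono-<-≤ f<g (fixes-≤ xs f≤g)
  fixes-< {xs = y ∷ _}  f≤g (there x∈)  f<g = ℕₚ.+-mono-≤-< (f≤g y) (fixes-< f≤g x∈ f<g)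

  -- Meant for two maps obtained from `f` and `g` by exchanging their values at some points: the
  -- total number of fixed points is conserved.
  fixes-+ : ∀ {f g f′ g′} xs → (∀ x → χ f′ x + χ g′ x ≡ χ f x + χ g x) →
    fixes f′ xs + fixes g′ xs ≡ fixes f xs + fixes g xs
  fixes-+ []       eq = refl
  fixes-+ {f} {g} {f′} {g′} (x ∷ xs) eq = begin
    (χ f′ x + fixes f′ xs) + (χ g′ x + fixes g′ xs)  ≡⟨ interchange (χ f′ x) _ _ _ ⟩
    (χ f′ x + χ g′ x) + (fixes f′ xs + fixes g′ xs)  ≡⟨ cong₂ _+_ (eq x) (fixes-+ xs eq) ⟩
    (χ f x + χ g x) + (fixes f xs + fixes g xs)      ≡⟨ interchange (χ f x) _ _ _ ⟩
    (χ f x + fixes f xs) + (χ g x + fixes g xs)      ∎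
    where open ≡-Reasoning

  fixed-point : ∀ {f} xs → 1 ≤ fixes f xs → ∃ λ x → x ∈ₗ xs × f x ≡ x
  fixed-point {f} (x ∷ xs) 1≤ with f x ≟ x
  ... | yes fx≡x = x , here refl , fx≡x
  ... | no  _    with y , y∈ , fy≡y ← fixed-point xs 1≤ = y , there y∈ , fy≡y

  two-fixed-points : ∀ {f} xs → Unique xs → 2 ≤ fixes f xs →
    ∃ λ x → ∃ λ y → x ≢ y × f x ≡ x × f y ≡ y
  two-fixed-points {f} (x ∷ xs) (x∉ ∷ xs!) 2≤ with f x ≟ x
  ... | no  _    = two-fixed-points xs xs! 2≤
  ... | yes fx≡x with y , y∈ , fy≡y ← fixed-point {f} xs (ℕₚ.≤-pred 2≤)
                 = x , y , All.lookup x∉ y∈ , fx≡x , fy≡y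

-- Gallai's lemma for vertex-transitive graphs: if u ∼ x and x ∼ v, where a ∼ b says that
-- a matching exposing both a and b can be improved, then u ∼ v. Indeed let M expose u and v
-- and let N be a translate of M exposing x. The component of x in M ∪ N contains at most one
-- vertex exposed by M, so misses one of u and v; exchanging M and N along this component
-- exposes x as well as that vertex, or makes M or N smaller.
module Matchings {V : Set} (_≟_ : DecidableEquality V)
  (vertices : List V) (vertices! : Unique vertices) (complete : ∀ v → v ∈ₗ vertices)
  (Adj : V → V → Set) (Adj-sym : ∀ {u v} → Adj u v → Adj v u) where

  open FixedPoints _≟_

  -- A matching is an involution; the vertices it exposes are its fixed points.
  record Matching : Set where
    field
      partner    : V → V
      involutive : ∀ v → partner (partner v) ≡ v
      adjacent   : ∀ v → partner v ≡ v ⊎ Adj v (partner v)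
  open Matching

  exposed : Matching → ℕ
  exposed M = fixes (partner M) vertices

  Improvable : ℕ → Set
  Improvable t = ∃ λ M → exposed M < t

  -- Translates of matchings under automorphisms.

  record Automorphism : Set where
    field
      to from  : V → V
      to∘from  : ∀ v → to (from v) ≡ v
      from∘to  : ∀ v → from (to v) ≡ v
      Adj-to   : ∀ {u v} → Adj u v → Adj (to u) (to v)

  translate : Automorphism → Matching → Matching
  translate σ M = record
    { partner    = λ v → to (partner M (from v))
    ; involutive = λ v → trans (cong (to ∘ partner M) (from∘to _))
                           (trans (cong to (involutive M (from v))) (to∘from v))
    ; adjacent   = λ v → adj v (adjacent M (from v))
    }
    where
    open Automorphism σ
    adj : ∀ v → partner M (from v) ≡ from v ⊎ Adj (from v) (partner M (from v)) →
      to (partner M (from v)) ≡ v ⊎ Adj v (to (partner M (from v)))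
    adj v (inj₁ eq) = inj₁ (trans (cong to eq) (to∘from v))
    adj v (inj₂ a)  = inj₂ (subst (λ w → Adj w (to (partner M (from v)))) (to∘from v) (Adj-to a))

  -- Conjugation carries fixed points to fixed points, and `from` merely permutes the list of
  -- vertices.
  exposed-translate : ∀ σ M → exposed (translate σ M) ≡ exposed M
  exposed-translate σ M = begin
    sum (map (χ (partner (translate σ M))) vertices)  ≡⟨ cong sum (map-cong χ-translate vertices) ⟩
    sum (map (χ (partner M) ∘ from) vertices)         ≡⟨ cong sum (map-∘ vertices) ⟩
    fixes (partner M) (map from vertices)             ≡⟨ fixes-↭ (partner M) from-↭ ⟩
    exposed M                                         ∎
    where
    open ≡-Reasoning
    open Automorphism σ

    from-injective : ∀ {u v} → from u ≡ from v → u ≡ v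
    from-injective eq = trans (sym (to∘from _)) (trans (cong to eq) (to∘from _))

    to-injective : ∀ {u v} → to u ≡ to v → u ≡ v
    to-injective eq = trans (sym (from∘to _)) (trans (cong from eq) (from∘to _))

    χ-translate : ∀ v → χ (partner (translate σ M)) v ≡ χ (partner M) (from v)
    χ-translate v with partner M (from v) ≟ from v
    ... | yes eq = χ-fixed {partner (translate σ M)} (trans (cong to eq) (to∘from v))
    ... | no neq = χ-moved {partner (translate σ M)}
                   (λ eq → neq (to-injective (trans eq (sym (to∘from v)))))

    from-↭ : map from vertices ↭ vertices
    from-↭ = unique-set⇒↭ (Uniq.map⁺ from-injective vertices!) vertices!
      (λ _ → complete _)
      (λ {v} _ → subst (_∈ₗ map from vertices) (from∘to v) (∈-map⁺ from (complete (to v))))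

  -- Exchanging two matchings along a closed set of vertices.

  Closed : (V → Set) → (V → V) → Set
  Closed S f = ∀ {v} → S v → S (f v)

  -- The splice follows `N` inside `S` and `M` outside. Closure under both partner maps ensures that
  -- no matched pair is cut.
  module Splice (S : V → Set) (S? : ∀ v → Dec (S v)) (M N : Matching)
    (S-M : Closed S (partner M)) (S-N : Closed S (partner N)) where

    swap : V → V
    swap v = if does (S? v) then partner N v else partner M v

    swap-in : ∀ {v} → S v → swap v ≡ partner N v
    swap-in {v} s rewrite dec-true (S? v) s = refl

    swap-out : ∀ {v} → ¬ S v → swap v ≡ partner M v
    swap-out {v} ¬s rewrite dec-false (S? v) ¬s = refl

    S-M⁻ : ∀ {v} → S (partner M v) → S v
    S-M⁻ {v} s = subst S (involutive M v) (S-M s)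

    splice : Matching
    splice = record
      { partner    = swap
      ; involutive = λ v → inv v (S? v)
      ; adjacent   = λ v → adj v (S? v)
      }
      where
      inv : ∀ v → Dec (S v) → swap (swap v) ≡ v
      inv v (yes s) = trans (cong swap (swap-in s)) (trans (swap-in (S-N s)) (involutive N v))
      inv v (no ¬s) = trans (cong swap (swap-out ¬s))
                        (trans (swap-out (¬s ∘ S-M⁻)) (involutive M v))

      adj : ∀ v → Dec (S v) → swap v ≡ v ⊎ Adj v (swap v)
      adj v (yes s) = subst (λ w → w ≡ v ⊎ Adj v w) (sym (swap-in s)) (adjacent N v)
      adj v (no ¬s) = subst (λ w → w ≡ v ⊎ Adj v w) (sym (swap-out ¬s)) (adjacent M v)

  -- The two opposite splices together use `M` once and `N` once at every vertex.
  exposed-splice : ∀ S S? M N (S-M : Closed S (partner M)) (S-N : Closed S (partner N)) →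
    exposed (Splice.splice S S? M N S-M S-N) + exposed (Splice.splice S S? N M S-N S-M)
      ≡ exposed M + exposed N
  exposed-splice S S? M N S-M S-N = 
    fixes-+ {partner M} {partner N} {MN.swap} {NM.swap} vertices (λ v → χ-splice v (S? v))
    where
    module MN = Splice S S? M N S-M S-N
    module NM = Splice S S? N M S-N S-M
    χ-splice : ∀ v → Dec (S v) →
      χ MN.swap v + χ NM.swap v ≡ χ (partner M) v + χ (partner N) v
    χ-splice v (yes s) = trans (cong₂ _+_ (χ-cong MN.swap (partner N) (MN.swap-in s))
                                 (χ-cong NM.swap (partner M) (NM.swap-in s)))
                               (ℕₚ.+-comm (χ (partner N) v) _)
    χ-splice v (no ¬s) = cong₂ _+_ (χ-cong MN.swap (partner M) (MN.swap-out ¬s))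
                          (χ-cong NM.swap (partner N) (NM.swap-out ¬s))

  add-edge : ∀ {u v} M → u ≢ v → Adj u v → partner M u ≡ u → partner M v ≡ v →
    Improvable (exposed M)
  add-edge {u} {v} M u≢v u–v Mu Mv = M′ , fixes-< {p} {m} χ≤ (complete u) χ<
    where
    m : V → V
    m = partner M

    p : V → V
    p w = if does (w ≟ u) then v else if does (w ≟ v) then u else m w

    p-u : p u ≡ v
    p-u rewrite dec-true (u ≟ u) refl = refl

    p-v : p v ≡ u
    p-v rewrite dec-false (v ≟ u) (u≢v ∘ sym) | dec-true (v ≟ v) refl = refl

    p-other : ∀ {w} → w ≢ u → w ≢ v → p w ≡ m w
    p-other {w} w≢u w≢v rewrite dec-false (w ≟ u) w≢u | dec-false (w ≟ v) w≢v = refl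

    m-≢ : ∀ {w z} → m z ≡ z → w ≢ z → m w ≢ z
    m-≢ {w} {z} mz w≢z mw≡z =
      w≢z (trans (sym (involutive M w)) (trans (cong m mw≡z) mz))

    -- Abstracting over a relation between a vertex and its new partner lets one case split prove
    -- involutivity, adjacency and the count.
    p-cases : ∀ {P : V → V → Set} → P u v → P v u → (∀ w → w ≢ u → w ≢ v → P w (m w)) →
      ∀ w → P w (p w)
    p-cases {P} Pu Pv Pw w with w ≟ u | w ≟ v
    ... | yes refl | _        = Pu
    ... | no _     | yes refl = Pv
    ... | no w≢u   | no w≢v   = Pw w w≢u w≢v

    M′ : Matching
    M′ = record
      { partner    = p
      ; involutive = p-cases {λ w z → p z ≡ w} p-v p-u (λ w w≢u w≢v →
                       trans (p-other (m-≢ Mu w≢u) (m-≢ Mv w≢v)) (involutive M w))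
      ; adjacent   = p-cases {λ w z → z ≡ w ⊎ Adj w z} (inj₂ u–v) (inj₂ (Adj-sym u–v))
                       (λ w _ _ → adjacent M w)
      }

    χ-p-u : χ p u ≡ 0
    χ-p-u = χ-moved {p} (λ eq → u≢v (trans (sym eq) p-u))

    χ≤ : ∀ w → χ p w ≤ χ m w
    χ≤ = p-cases {λ w z → (if does (z ≟ w) then 1 else 0) ≤ χ m w}
      -- `χ` at a vertex depends only on the value of the map there, so a constant map can stand for
      -- `p`.
      (subst (_≤ χ m u) (sym (χ-moved {λ _ → v} (u≢v ∘ sym))) z≤n)
      (subst (_≤ χ m v) (sym (χ-moved {λ _ → u} u≢v)) z≤n)
      (λ _ _ _ → ℕₚ.≤-refl)

    χ< : χ p u < χ m u
    χ< rewrite χ-p-u | χ-fixed {m} Mu = s≤s z≤n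

  -- Reading a matching as a partition into singletons and pairs.

  Part : List V → Set
  Part P = (∃ λ u → P ≡ u ∷ []) ⊎ (∃ λ u → ∃ λ v → P ≡ u ∷ v ∷ [] × Adj u v)

  -- Doubling the number of parts avoids halves: a pair accounts for its two vertices, a singleton
  -- for its vertex and for that vertex being exposed.
  pairing : ∀ M → ∃ λ Ps → concat Ps ↭ vertices × All Part Ps ×
    length Ps + length Ps ≡ length vertices + exposed M
  pairing M = go (length vertices) vertices ℕₚ.≤-refl vertices! (λ _ → complete _)
    where
    m : V → V
    m = partner M

    m-injective : ∀ {u v} → m u ≡ m v → u ≡ v
    m-injective {u} {v} eq = trans (sym (involutive M u)) (trans (cong m eq) (involutive M v))

    closed-single : ∀ {v vs} → m v ≡ v → Unique (v ∷ vs) → Closed (_∈ₗ v ∷ vs) m →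
      Closed (_∈ₗ vs) m
    closed-single mv≡v (v∉ ∷ _) closed u∈ with closed (there u∈)
    ... | there mu∈ = mu∈
    ... | here mu≡v = contradiction (m-injective (trans mv≡v (sym mu≡v))) (All.lookup v∉ u∈)

    closed-pair : ∀ {v vs} → Unique (v ∷ m v ∷ vs) → Closed (_∈ₗ v ∷ m v ∷ vs) m →
      Closed (_∈ₗ vs) m
    closed-pair {v} ((_ ∷ v∉) ∷ mv∉ ∷ _) closed {u} u∈ with closed (there (there u∈))
    ... | there (there mu∈) = mu∈
    ... | there (here eq)   = contradiction (sym (m-injective eq)) (All.lookup v∉ u∈)
    ... | here mu≡v         =
            contradiction (trans (cong m (sym mu≡v)) (involutive M u)) (All.lookup mv∉ u∈)

    Pairing : List V → Set
    Pairing vs = ∃ λ Ps → concat Ps ↭ vs × All Part Ps ×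
      length Ps + length Ps ≡ length vs + fixes m vs

    add-single : ∀ {v vs} → m v ≡ v → Pairing vs → Pairing (v ∷ vs)
    add-single {v} {vs} mv≡v (Ps , concat↭ , ps , len) =
      (v ∷ []) ∷ Ps , ↭-prep v concat↭ , inj₁ (v , refl) ∷ ps , cong suc (begin
        length Ps + suc (length Ps)              ≡⟨ ℕₚ.+-suc (length Ps) _ ⟩
        suc (length Ps + length Ps)              ≡⟨ cong suc len ⟩
        suc (length vs + fixes m vs)             ≡⟨ ℕₚ.+-suc (length vs) _ ⟨
        length vs + suc (fixes m vs)             ≡⟨ cong (λ c → length vs + (c + fixes m vs))
                                                         (χ-fixed {m} mv≡v) ⟨
        length vs + fixes m (v ∷ vs)             ∎)
      where open ≡-Reasoning

    add-pair : ∀ {v vs} → m v ≢ v → Pairing vs → Pairing (v ∷ m v ∷ vs)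
    add-pair {v} {vs} mv≢v (Ps , concat↭ , ps , len) =
      (v ∷ m v ∷ []) ∷ Ps , ↭-prep v (↭-prep (m v) concat↭) ,
      inj₂ (v , m v , refl , v–mv (adjacent M v)) ∷ ps , cong suc (begin
        length Ps + suc (length Ps)              ≡⟨ ℕₚ.+-suc (length Ps) _ ⟩
        suc (length Ps + length Ps)              ≡⟨ cong suc len ⟩
        suc (length vs + fixes m vs)             ≡⟨ cong (λ c → suc (length vs) + (c + fixes m vs))
                                                         (χ-moved {m} (mv≢v ∘ m-injective)) ⟨
        suc (length vs) + fixes m (m v ∷ vs)     ≡⟨ cong (λ c → suc (length vs) +
                                                           (c + fixes m (m v ∷ vs)))
                                                         (χ-moved {m} mv≢v) ⟨
        suc (length vs) + fixes m (v ∷ m v ∷ vs) ∎)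
      where
      open ≡-Reasoning
      v–mv : m v ≡ v ⊎ Adj v (m v) → Adj v (m v)
      v–mv (inj₁ eq) = contradiction eq mv≢v
      v–mv (inj₂ a)  = a

    Pairing-↭ : ∀ {us vs} → us ↭ vs → Pairing us → Pairing vs
    Pairing-↭ us↭vs (Ps , concat↭ , ps , len) = Ps , ↭-trans concat↭ us↭vs , ps ,
      trans len (cong₂ _+_ (Perm.↭-length us↭vs) (fixes-↭ m us↭vs))

    go : ∀ bound vs → length vs ≤ bound → Unique vs → Closed (_∈ₗ vs) m → Pairing vs
    -- Removing `m v` from the middle of the list leaves no structural tail, so the recursion is on
    -- a bound for the length.
    go _ [] _ _ _ = [] , ↭-refl , [] , refl
    go (suc bound) (v ∷ vs) (s≤s le) vs! closed with toSum (m v ≟ v)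
    ... | inj₁ mv≡v = add-single mv≡v
                        (go bound vs le (AllPairs.tail vs!) (closed-single mv≡v vs! closed))
    ... | inj₂ mv≢v with closed (here refl)
    ...   | here mv≡v = contradiction mv≡v mv≢v
    ...   | there mv∈ with ws , zs , refl ← ∈-∃++ mv∈ =
      Pairing-↭ (↭-sym shift) (add-pair mv≢v
        (go bound (ws ++ zs) shorter (AllPairs.tail (AllPairs.tail rest!))
          (closed-pair rest! λ u∈ →
            Perm.∈-resp-↭ shift (closed (Perm.∈-resp-↭ (↭-sym shift) u∈)))))
      where
      shift : v ∷ ws ++ m v ∷ zs ↭ v ∷ m v ∷ ws ++ zs
      shift = ↭-prep v (Perm.shift (m v) ws zs)
      rest! : Unique (v ∷ m v ∷ ws ++ zs)
      rest! = PermSetoid.Unique-resp-↭ (setoid V) (↭⇒↭ₛ shift) vs!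
      shorter : length (ws ++ zs) ≤ bound
      shorter = ℕₚ.≤-trans (ℕₚ.n≤1+n _)
        (subst (_≤ bound) (Perm.↭-length (Perm.shift (m v) ws zs)) le)

  -- Gallai's lemma: improvability is a transitive relation.

  module _ (transitive : ∀ u v → Σ Automorphism λ σ → Automorphism.to σ u ≡ v) where

    -- Vertex-transitivity enters here, to move an exposed vertex to any prescribed place at no
    -- cost.
    expose : ∀ M u x → partner M u ≡ u → ∃ λ N → exposed N ≡ exposed M × partner N x ≡ x
    expose M u x Mu with σ , refl ← transitive u x =
      translate σ M , exposed-translate σ M ,
      cong to (trans (cong (partner M) (from∘to u)) Mu)
      where open Automorphism σ

    -- Equality has to be allowed: for equal vertices the second alternative would improve even a
    -- matching exposing just one vertex.
    _∼[_]_ : V → ℕ → V → Set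
    u ∼[ t ] v = u ≡ v ⊎
      (∀ M → exposed M ≡ t → partner M u ≡ u → partner M v ≡ v → Improvable t)

    ∼-sym : ∀ {t u v} → u ∼[ t ] v → v ∼[ t ] u
    ∼-sym (inj₁ eq)  = inj₁ (sym eq)
    ∼-sym (inj₂ imp) = inj₂ (λ M eq Mv Mu → imp M eq Mu Mv)

    -- The splice exposes `w`, which lies outside `S`, and `x`, which lies inside. If it exposes
    -- more than `t` vertices, the opposite splice exposes fewer, since the two counts add up to
    -- twice `t`.
    exchange : ∀ {S} S? M N (S-M : Closed S (partner M)) (S-N : Closed S (partner N)) {t w x} →
      exposed M ≡ t → exposed N ≡ t →
      ¬ S w → S x → partner M w ≡ w → partner N x ≡ x → w ∼[ t ] x → Improvable t
    exchange S? M N S-M S-N ∣M∣ ∣N∣ w∉S x∈S Mw Nx (inj₁ refl) = contradiction x∈S w∉S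
    exchange {S} S? M N S-M S-N {t} ∣M∣ ∣N∣ w∉S x∈S Mw Nx (inj₂ improve) =
      compare (ℕₚ.<-cmp (exposed MN.splice) t)
      where
      module MN = Splice S S? M N S-M S-N
      module NM = Splice S S? N M S-N S-M
      compare : Tri (exposed MN.splice < t) (exposed MN.splice ≡ t) (t < exposed MN.splice) →
        Improvable t
      compare (tri< less _ _) = MN.splice , less
      compare (tri≈ _ same _) = improve MN.splice same (trans (MN.swap-out w∉S) Mw)
                                                       (trans (MN.swap-in x∈S) Nx)
      compare (tri> _ _ more) = NM.splice , ℕₚ.≰⇒> λ t≤ → ℕₚ.<-irrefl
        (sym (trans (exposed-splice S S? M N S-M S-N) (cong₂ _+_ ∣M∣ ∣N∣)))
        (ℕₚ.+-mono-<-≤ more t≤)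

    ∼-trans : ∀ {t u x v} → u ∼[ t ] x → x ∼[ t ] v → u ∼[ t ] v
    ∼-trans {t} {u} {x} {v} u∼x x∼v with u ≟ v
    ... | yes u≡v = inj₁ u≡v
    ... | no  u≢v = inj₂ improve
      where
      improve : ∀ M → exposed M ≡ t → partner M u ≡ u → partner M v ≡ v → Improvable t
      improve M ∣M∣ Mu Mv with N , ∣N∣≡∣M∣ , Nx ← expose M u x Mu = go (Orbit? {p} per u)
        where
        open Dihedral _≟_ (partner M) (partner N) (involutive M) (involutive N) x Nx
        p   = proj₁ (periodic vertices complete π-injective x)
        per : iterate (suc p) ≡ x
        per = proj₂ (periodic vertices complete π-injective x)
        go : Dec (Orbit {p} per u) → Improvable t
        go (no u∉) = exchange (Orbit? {p} per) M N (μ-Orbit {p} per) (ν-Orbit {p} per)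
                       ∣M∣ (trans ∣N∣≡∣M∣ ∣M∣) u∉ (base∈Orbit {p} per) Mu Nx u∼x
        go (yes u∈) = exchange (Orbit? {p} per) M N (μ-Orbit {p} per) (ν-Orbit {p} per)
                       ∣M∣ (trans ∣N∣≡∣M∣ ∣M∣)
                       (λ v∈ → u≢v (Orbit-μ-fixed-unique {p} per u∈ v∈ Mu Mv))
                       (base∈Orbit {p} per) Mv Nx (∼-sym x∼v)

    connected⇒∼ : ∀ {t u v} → Star Adj u v → u ∼[ t ] v
    connected⇒∼ ε = inj₁ refl
    connected⇒∼ {u = u} (_◅_ {j = w} u–w w⋯v) = ∼-trans edge (connected⇒∼ w⋯v)
      where
      edge : ∀ {t} → u ∼[ t ] w
      -- `Adj` is not assumed irreflexive, and a loop could not be added to a matching.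
      edge with u ≟ w
      ... | yes u≡w = inj₁ u≡w
      ... | no  u≢w = inj₂ λ { M refl Mu Mw → add-edge M u≢w u–w Mu Mw }

    near-perfect-matching : (∀ u v → Star Adj u v) → ∃ λ M → exposed M ≤ 1
    near-perfect-matching connected = search (exposed empty) empty ℕₚ.≤-refl
      where
      empty : Matching
      empty = record { partner = id ; involutive = λ _ → refl ; adjacent = λ _ → inj₁ refl }

      search : ∀ bound M → exposed M ≤ bound → ∃ λ M → exposed M ≤ 1
      search zero        M le = M , ℕₚ.≤-trans le z≤n
      search (suc bound) M le with ℕₚ.≤-<-connex (exposed M) 1
      ... | inj₁ ≤1 = M , ≤1
      ... | inj₂ >1
        with u , v , u≢v , Mu , Mv ← two-fixed-points vertices vertices! >1
        with connected⇒∼ {exposed M} (connected u v)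
      ...   | inj₁ u≡v     = contradiction u≡v u≢v
      ...   | inj₂ improve with M′ , less ← improve M refl Mu Mv
                           = search bound M′ (ℕₚ.≤-pred (ℕₚ.≤-trans less le))

-- The r-subsets of an n-set.

KSubset : ℕ → ℕ → Set
KSubset n r = Σ (Subset n) λ e → ∣ e ∣ ≡ r

KSubset-≡ : ∀ {n r} {u v : KSubset n r} → proj₁ u ≡ proj₁ v → u ≡ v
KSubset-≡ {u = e , p} {_ , q} refl = cong (e ,_) (ℕₚ.≡-irrelevant p q)

_≟ₖ_ : ∀ {n r} → DecidableEquality (KSubset n r)
(e , _) ≟ₖ (f , _) = map′ KSubset-≡ (cong proj₁) (≡-dec Bool._≟_ e f)

add : ∀ {n r} → KSubset n r → KSubset (suc n) (suc r)
add (e , p) = inside ∷ e , cong suc p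

skip : ∀ {n r} → KSubset n r → KSubset (suc n) r
skip (e , p) = outside ∷ e , p

add-injective : ∀ {n r} {u v : KSubset n r} → add u ≡ add v → u ≡ v
add-injective eq = KSubset-≡ (∷-injectiveʳ (cong proj₁ eq))

skip-injective : ∀ {n r} {u v : KSubset n r} → skip u ≡ skip v → u ≡ v
skip-injective eq = KSubset-≡ (∷-injectiveʳ (cong proj₁ eq))

ksubsets : ∀ n r → List (KSubset n r)
ksubsets zero    zero    = ([] , refl) ∷ []
ksubsets zero    (suc r) = []
ksubsets (suc n) zero    = map skip (ksubsets n zero)
ksubsets (suc n) (suc r) = map add (ksubsets n r) ++ map skip (ksubsets n (suc r))

ksubsets-complete : ∀ n r (u : KSubset n r) → u ∈ₗ ksubsets n r
ksubsets-complete zero    _       ([] , refl)           = here refl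
ksubsets-complete (suc n) zero    (outside ∷ e , p)     =
  ∈-map⁺ skip (ksubsets-complete n zero (e , p))
ksubsets-complete (suc n) (suc r) (outside ∷ e , p)     =
  ∈-++⁺ʳ (map add (ksubsets n r)) (∈-map⁺ skip (ksubsets-complete n (suc r) (e , p)))
ksubsets-complete (suc n) (suc _) (inside ∷ e , refl)   =
  ∈-++⁺ˡ (∈-map⁺ add (ksubsets-complete n _ (e , refl)))

ksubsets! : ∀ n r → Unique (ksubsets n r)
ksubsets! zero    zero    = [] ∷ []
ksubsets! zero    (suc r) = []
ksubsets! (suc n) zero    = Uniq.map⁺ skip-injective (ksubsets! n zero)
ksubsets! (suc n) (suc r) = Uniq.++⁺ (Uniq.map⁺ add-injective (ksubsets! n r))
  (Uniq.map⁺ skip-injective (ksubsets! n (suc r))) disjoint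
  where
  disjoint : ∀ {u} → ¬ (u ∈ₗ map add (ksubsets n r) × u ∈ₗ map skip (ksubsets n (suc r)))
  disjoint (∈add , ∈skip) with ∈-map⁻ add ∈add | ∈-map⁻ skip ∈skip
  ... | _ , _ , refl | _ , _ , ()

nC0≡1 : ∀ n → n C 0 ≡ 1
nC0≡1 n = trans (nCk≡nC[n∸k] {0} {n} z≤n) (nCn≡1 n)

length-ksubsets : ∀ n r → length (ksubsets n r) ≡ n C r
length-ksubsets zero    zero    = refl
length-ksubsets zero    (suc r) = sym (k>n⇒nCk≡0 {0} {suc r} (s≤s z≤n))
length-ksubsets (suc n) zero    = begin
  length (map skip (ksubsets n 0))  ≡⟨ length-map skip (ksubsets n 0) ⟩
  length (ksubsets n 0)             ≡⟨ length-ksubsets n 0 ⟩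
  n C 0                             ≡⟨ nC0≡1 n ⟩
  1                                 ≡⟨ nC0≡1 (suc n) ⟨
  suc n C 0                         ∎
  where open ≡-Reasoning
length-ksubsets (suc n) (suc r) = begin
  length (map add (ksubsets n r) ++ map skip (ksubsets n (suc r)))
    ≡⟨ length-++ (map add (ksubsets n r)) ⟩
  length (map add (ksubsets n r)) + length (map skip (ksubsets n (suc r)))
    ≡⟨ cong₂ _+_ (trans (length-map add (ksubsets n r)) (length-ksubsets n r))
                 (trans (length-map skip (ksubsets n (suc r))) (length-ksubsets n (suc r))) ⟩
  n C r + n C suc r
    ≡⟨ nCk+nC[k+1]≡[n+1]C[k+1] n r ⟩
  suc n C suc r ∎
  where open ≡-Reasoning

-- Swaps of neighbouring coordinates.

-- Only an element and its immediate successor are exchanged, in one direction; this keeps every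
-- induction structural, and equivalence closure restores generality.
data Swap : ∀ {n} → Subset n → Subset n → Set where
  here  : ∀ {n} {e : Subset n} → Swap (inside ∷ outside ∷ e) (outside ∷ inside ∷ e)
  there : ∀ {n} x {e f : Subset n} → Swap e f → Swap (x ∷ e) (x ∷ f)

-- Only the position of the swap is used: it acts on all subsets as a transposition of the ground
-- set, hence as an automorphism.
transpose : ∀ {n} {e f : Subset n} → Swap e f → Subset n → Subset n
transpose here        (x ∷ y ∷ s) = y ∷ x ∷ s
transpose (there _ w) (x ∷ s)     = x ∷ transpose w s

transpose-involutive : ∀ {n} {e f : Subset n} (w : Swap e f) s → transpose w (transpose w s) ≡ s
transpose-involutive here        (x ∷ y ∷ s) = refl
transpose-involutive (there _ w) (x ∷ s)     = cong (x ∷_) (transpose-involutive w s)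

transpose-∩ : ∀ {n} {e f : Subset n} (w : Swap e f) s t →
  transpose w s ∩ transpose w t ≡ transpose w (s ∩ t)
transpose-∩ here        (x ∷ y ∷ s) (x′ ∷ y′ ∷ t) = refl
transpose-∩ (there _ w) (x ∷ s)     (y ∷ t)       = cong (_ ∷_) (transpose-∩ w s t)

∣∷∣-cong : ∀ {m n} x (p : Subset m) (q : Subset n) → ∣ p ∣ ≡ ∣ q ∣ → ∣ x ∷ p ∣ ≡ ∣ x ∷ q ∣
∣∷∣-cong inside  p q eq = cong suc eq
∣∷∣-cong outside p q eq = eq

∣transpose∣ : ∀ {n} {e f : Subset n} (w : Swap e f) s → ∣ transpose w s ∣ ≡ ∣ s ∣
∣transpose∣ here        (inside  ∷ inside  ∷ s) = refl
∣transpose∣ here        (inside  ∷ outside ∷ s) = refl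
∣transpose∣ here        (outside ∷ inside  ∷ s) = refl
∣transpose∣ here        (outside ∷ outside ∷ s) = refl
∣transpose∣ (there _ w) (x ∷ s)                 = ∣∷∣-cong x (transpose w s) s (∣transpose∣ w s)

transpose-Swap : ∀ {n} {e f : Subset n} (w : Swap e f) → transpose w e ≡ f
transpose-Swap here        = refl
transpose-Swap (there x w) = cong (x ∷_) (transpose-Swap w)

transpose-Swap⁻ : ∀ {n} {e f : Subset n} (w : Swap e f) → transpose w f ≡ e
transpose-Swap⁻ here        = refl
transpose-Swap⁻ (there x w) = cong (x ∷_) (transpose-Swap⁻ w)

Swap-∣∣ : ∀ {n} {e f : Subset n} → Swap e f → ∣ e ∣ ≡ ∣ f ∣
Swap-∣∣ w = trans (sym (∣transpose∣ w _)) (cong ∣_∣ (transpose-Swap w))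

Swap-bounds : ∀ {n} {e f : Subset n} → Swap e f → 1 ≤ ∣ e ∣ × ∣ e ∣ < n
Swap-bounds (here {e = e}) = s≤s z≤n , s≤s (s≤s (∣p∣≤n e))
Swap-bounds (there inside  w) with 1≤ , <n ← Swap-bounds w = s≤s z≤n , s≤s <n
Swap-bounds (there outside w) with 1≤ , <n ← Swap-bounds w = 1≤ , ℕₚ.m<n⇒m<1+n <n

subset-of-size : ∀ {j n} → j ≤ n → KSubset n j
subset-of-size {n = n} z≤n = ⊥ , ∣⊥∣≡0 n
subset-of-size (s≤s j≤n)   = add (subset-of-size j≤n)

swaps : ∀ n (e f : Subset n) → ∣ e ∣ ≡ ∣ f ∣ → EqClosure Swap e f

-- Free the first coordinate of `e` by rearranging it into `outside ∷ g`, exchange the two heads,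
-- then rearrange `inside ∷ g` into `f`. There is room for `g` because `f` has one element more than
-- `e`.
swaps-in-out : ∀ n (e f : Subset n) → suc ∣ e ∣ ≡ ∣ f ∣ →
  EqClosure Swap (inside ∷ e) (outside ∷ f)
swaps-in-out zero    []  []  ()
swaps-in-out (suc n) e f eq =
  let g , ∣g∣ = subset-of-size (ℕₚ.≤-pred (subst (_≤ suc n) (sym eq) (∣p∣≤n f)))
  in Eq.gmap (inside ∷_) (there inside) (swaps (suc n) e (outside ∷ g) (sym ∣g∣))
     ◅◅ fwd here
     ◅ Eq.gmap (outside ∷_) (there outside)
         (swaps (suc n) (inside ∷ g) f (trans (cong suc ∣g∣) eq))

swaps zero    []            []            _  = ε
swaps (suc n) (inside ∷ e)  (inside ∷ f)  eq =
  Eq.gmap (inside ∷_) (there inside) (swaps n e f (ℕₚ.suc-injective eq))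
swaps (suc n) (outside ∷ e) (outside ∷ f) eq =
  Eq.gmap (outside ∷_) (there outside) (swaps n e f eq)
swaps (suc n) (inside ∷ e)  (outside ∷ f) eq = swaps-in-out n e f eq
swaps (suc n) (outside ∷ e) (inside ∷ f)  eq =
  Eq.symmetric Swap (swaps-in-out n f e (sym eq))

swapsₖ : ∀ {n r} (u v : KSubset n r) → EqClosure (Swap on proj₁) u v
swapsₖ (e , p) (f , q) = lift (swaps _ e f (trans p (sym q))) p q
  where
  lift : ∀ {n r} {e f : Subset n} → EqClosure Swap e f → ∀ (p : ∣ e ∣ ≡ r) (q : ∣ f ∣ ≡ r) →
    EqClosure (Swap on proj₁) (e , p) (f , q)
  lift ε             p q = subst (λ q → Star _ _ (_ , q)) (ℕₚ.≡-irrelevant p q) ε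
  lift (fwd w ◅ ws) p q = fwd w ◅ lift ws (trans (sym (Swap-∣∣ w)) p) q
  lift (bwd w ◅ ws) p q = bwd w ◅ lift ws (trans (Swap-∣∣ w) p) q

-- Common neighbours of two subsets that differ by a swap.

+-suc-cancel-≤ : ∀ q {m n} → q + suc m ≤ suc n → q + m ≤ n
+-suc-cancel-≤ q {m} {n} le = ℕₚ.≤-pred (subst (_≤ suc n) (ℕₚ.+-suc q m) le)

-- A greedy choice of `t` elements inside `e` and `q` outside it; the two bounds say that there is
-- room for each.
split-size : ∀ {n} (e : Subset n) t q → t ≤ ∣ e ∣ → q + ∣ e ∣ ≤ n →
  Σ (Subset n) λ w → ∣ w ∣ ≡ t + q × ∣ w ∩ e ∣ ≡ t
split-size []            zero    zero    _       _ = [] , refl , refl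
split-size (inside ∷ e)  zero    q       _       q≤
  with w , ∣w∣ , ∣w∩e∣ ← split-size e zero q z≤n
                           (+-suc-cancel-≤ q q≤)
  = outside ∷ w , ∣w∣ , ∣w∩e∣
split-size (inside ∷ e)  (suc t) q       (s≤s t≤) q≤
  with w , ∣w∣ , ∣w∩e∣ ← split-size e t q t≤
                           (+-suc-cancel-≤ q q≤)
  = inside ∷ w , cong suc ∣w∣ , cong suc ∣w∩e∣
split-size (outside ∷ e) t       zero    t≤      _
  with w , ∣w∣ , ∣w∩e∣ ← split-size e t zero t≤ (∣p∣≤n e)
  = outside ∷ w , ∣w∣ , ∣w∩e∣
split-size (outside ∷ e) t       (suc q) t≤      (s≤s q≤)
  with w , ∣w∣ , ∣w∩e∣ ← split-size e t q t≤ q≤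
  = inside ∷ w , trans (cong suc ∣w∣) (sym (ℕₚ.+-suc t q)) , ∣w∩e∣

bit : Bool → ℕ
bit b = if b then 1 else 0

-- The bit b says whether w contains both of the swapped elements or neither of them.
common-neighbour : ∀ {n} {e f : Subset n} → Swap e f → ∀ b t q →
  t < ∣ e ∣ → q + suc ∣ e ∣ ≤ n →
  Σ (Subset n) λ w → ∣ w ∣ ≡ (bit b + bit b) + (t + q) ×
    ∣ w ∩ e ∣ ≡ bit b + t × ∣ w ∩ f ∣ ≡ bit b + t
common-neighbour (here {e = e}) b t q (s≤s t≤) q≤
  with w , ∣w∣ , ∣w∩e∣ ← split-size e t q t≤ (+-suc-cancel-≤ q (+-suc-cancel-≤ q q≤))
  with b
... | inside  = inside ∷ inside ∷ w , cong (2 +_) ∣w∣ , cong suc ∣w∩e∣ , cong suc ∣w∩e∣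
... | outside = outside ∷ outside ∷ w , ∣w∣ , ∣w∩e∣ , ∣w∩e∣
-- When `t` is zero the hypothesis says nothing about the tail, but the swap lying in it supplies
-- the element required; `q` equal to zero is treated likewise.
common-neighbour (there inside {e} v) b zero q _ q≤
  with w , ∣w∣ , ∣w∩e∣ , ∣w∩f∣ ← common-neighbour v b zero q (proj₁ (Swap-bounds v))
         (+-suc-cancel-≤ q q≤)
  = outside ∷ w , ∣w∣ , ∣w∩e∣ , ∣w∩f∣
common-neighbour (there inside {e} v) b (suc t) q (s≤s t<) q≤
  with w , ∣w∣ , ∣w∩e∣ , ∣w∩f∣ ← common-neighbour v b t q t<
         (+-suc-cancel-≤ q q≤)
  = inside ∷ w , trans (cong suc ∣w∣) (sym (ℕₚ.+-suc (bit b + bit b) (t + q)))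
  , trans (cong suc ∣w∩e∣) (sym (ℕₚ.+-suc (bit b) t))
  , trans (cong suc ∣w∩f∣) (sym (ℕₚ.+-suc (bit b) t))
common-neighbour (there outside v) b t zero t< _
  with w , ∣w∣ , ∣w∩e∣ , ∣w∩f∣ ← common-neighbour v b t zero t< (proj₂ (Swap-bounds v))
  = outside ∷ w , ∣w∣ , ∣w∩e∣ , ∣w∩f∣
common-neighbour (there outside v) b t (suc q) t< (s≤s q≤)
  with w , ∣w∣ , ∣w∩e∣ , ∣w∩f∣ ← common-neighbour v b t q t< q≤
  = inside ∷ w
  , trans (cong suc ∣w∣) (trans (sym (ℕₚ.+-suc (bit b + bit b) (t + q)))
                                (cong ((bit b + bit b) +_) (sym (ℕₚ.+-suc t q))))
  , ∣w∩e∣ , ∣w∩f∣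

-- Generalised Johnson graphs and their matchings.

Adj : ∀ {n r} → ℕ → KSubset n r → KSubset n r → Set
Adj k (e , _) (f , _) = ∣ e ∩ f ∣ ≡ k

Adj-sym : ∀ {n r k} {u v : KSubset n r} → Adj k u v → Adj k v u
Adj-sym {u = e , _} {f , _} eq = trans (cong ∣_∣ (∩-comm f e)) eq

module Johnson (n r k : ℕ) where

  open Matchings (_≟ₖ_ {n} {r}) (ksubsets n r) (ksubsets! n r) (ksubsets-complete n r)
    (Adj k) (λ {u} {v} → Adj-sym {u = u} {v}) public

  identity : Automorphism
  identity = record
    { to = id ; from = id ; to∘from = λ _ → refl ; from∘to = λ _ → refl ; Adj-to = id }

  compose : Automorphism → Automorphism → Automorphism
  compose σ τ = record
    { to      = T.to ∘ S.to
    ; from    = S.from ∘ T.from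
    ; to∘from = λ v → trans (cong T.to (S.to∘from _)) (T.to∘from v)
    ; from∘to = λ v → trans (cong S.from (T.from∘to _)) (S.from∘to v)
    ; Adj-to  = λ {u} {v} a → T.Adj-to {S.to u} {S.to v} (S.Adj-to {u} {v} a)
    }
    where
    module S = Automorphism σ
    module T = Automorphism τ

  transposition : ∀ {e f : Subset n} → Swap e f → Automorphism
  transposition w = record
    { to      = act
    ; from    = act
    ; to∘from = λ v → KSubset-≡ (transpose-involutive w (proj₁ v))
    ; from∘to = λ v → KSubset-≡ (transpose-involutive w (proj₁ v))
    ; Adj-to  = λ {u} {v} a →
        trans (cong ∣_∣ (transpose-∩ w (proj₁ u) (proj₁ v)))
          (trans (∣transpose∣ w (proj₁ u ∩ proj₁ v)) a)
    }
    where
    act : KSubset n r → KSubset n r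
    act (e , p) = transpose w e , trans (∣transpose∣ w e) p

  transitive : ∀ u v → Σ Automorphism λ σ → Automorphism.to σ u ≡ v
  transitive u v = go (swapsₖ u v)
    where
    go : ∀ {u v : KSubset n r} → EqClosure (Swap on proj₁) u v →
      Σ Automorphism λ σ → Automorphism.to σ u ≡ v
    go ε = identity , refl
    go (fwd w ◅ ws) with τ , eq ← go ws =
      compose (transposition w) τ ,
      trans (cong (Automorphism.to τ) (KSubset-≡ (transpose-Swap w))) eq
    go (bwd w ◅ ws) with τ , eq ← go ws =
      compose (transposition w) τ ,
      trans (cong (Automorphism.to τ) (KSubset-≡ (transpose-Swap⁻ w))) eq

  -- A common neighbour takes `t` elements from the intersection of the swapped subsets, which has r
  -- - 1 elements, and `q` from outside their union, which has r + 1; hence the two bounds.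
  connected : ∀ b t q → bit b + t ≡ k → (bit b + bit b) + (t + q) ≡ r → t < r → q + suc r ≤ n →
    ∀ u v → Star (Adj k) u v
  connected b t q k≡ r≡ t<r q≤ u v = go (swapsₖ u v)
    where
    detour : ∀ {u v : KSubset n r} → Swap (proj₁ u) (proj₁ v) → Star (Adj k) u v × Star (Adj k) v u
    detour {u@(e , p)} {v} s
      with w , ∣w∣ , ∣w∩e∣ , ∣w∩f∣ ← common-neighbour s b t q
             (subst (t <_) (sym p) t<r) (subst (λ m → q + suc m ≤ n) (sym p) q≤) =
      (_◅_ {j = x} (Adj-sym {u = x} {u} x–u) (x–v ◅ ε)) ,
      (_◅_ {j = x} (Adj-sym {u = x} {v} x–v) (x–u ◅ ε))
      where
      x : KSubset n r
      x = w , trans ∣w∣ r≡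
      x–u = trans ∣w∩e∣ k≡
      x–v = trans ∣w∩f∣ k≡

    go : ∀ {u v : KSubset n r} → EqClosure (Swap on proj₁) u v → Star (Adj k) u v
    go ε            = ε
    go (fwd w ◅ ws) = proj₁ (detour w) ◅◅ go ws
    go (bwd w ◅ ws) = proj₂ (detour w) ◅◅ go ws

complement-matching : ∀ {n r} → 1 ≤ r → n ≡ r + r → (let open Johnson n r 0) →
  ∃ λ M → exposed M ≤ 1
complement-matching {n} {r} 1≤r n≡2r =
  M , subst (_≤ 1) (sym (fixes-none (ksubsets n r) moved)) z≤n
  where
  open Johnson n r 0
  open FixedPoints (_≟ₖ_ {n} {r})

  ∩-∁-empty : ∀ (e : Subset n) → ∣ e ∩ ∁ e ∣ ≡ 0
  ∩-∁-empty e = trans (cong ∣_∣ (∩-inverseʳ e)) (∣⊥∣≡0 n)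

  complement : KSubset n r → KSubset n r
  complement (e , p) = ∁ e , (begin
    ∣ ∁ e ∣      ≡⟨ ∣∁p∣≡n∸∣p∣ e ⟩
    n ∸ ∣ e ∣    ≡⟨ cong₂ _∸_ n≡2r p ⟩
    r + r ∸ r    ≡⟨ ℕₚ.m+n∸n≡m r r ⟩
    r            ∎)
    where open ≡-Reasoning

  ∁-involutive : ∀ {n} (e : Subset n) → ∁ (∁ e) ≡ e
  ∁-involutive []      = refl
  ∁-involutive (x ∷ e) = cong₂ _∷_ (Bool.not-involutive x) (∁-involutive e)

  moved : ∀ u → complement u ≢ u
  moved (e , p) eq = ℕₚ.<-irrefl (begin
    0                ≡⟨ ∩-∁-empty e ⟨
    ∣ e ∩ ∁ e ∣      ≡⟨ cong (λ f → ∣ e ∩ f ∣) (cong proj₁ eq) ⟩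
    ∣ e ∩ e ∣        ≡⟨ cong ∣_∣ (∩-idem e) ⟩
    ∣ e ∣            ≡⟨ p ⟩
    r                ∎) 1≤r
    where open ≡-Reasoning

  M : Matching
  M = record
    { partner    = complement
    ; involutive = λ u → KSubset-≡ (∁-involutive (proj₁ u))
    ; adjacent   = λ u → inj₂ (∩-∁-empty (proj₁ u))
    }

-- Here r is k + 1 + d, so the bound is n ≥ 2r - k. If it is strict, a common neighbour can avoid
-- both swapped elements. At equality there are too few points outside for this, and it contains
-- both instead; one of them then counts towards the intersection, which takes k ≥ 1.
johnson-matching′ : ∀ n k d → suc (k + d) + suc d ≤ n → (let open Johnson n (suc (k + d)) k) →
  ∃ λ M → exposed M ≤ 1
johnson-matching′ n k d le = case (ℕₚ.m≤n⇒m<n∨m≡n le)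
  where
  open Johnson n (suc (k + d)) k

  neither : ∀ k d → suc (suc (k + d) + suc d) ≡ suc d + suc (suc (k + d))
  neither = solve-∀

  both : ∀ k d → d + suc (suc (suc k + d)) ≡ suc (suc k + d) + suc d
  both = solve-∀

  boundary : ∀ k → suc (k + d) + suc d ≡ n → (let module J = Johnson n (suc (k + d)) k) →
    ∃ λ M → J.exposed M ≤ 1
  boundary zero    eq = complement-matching (s≤s z≤n) (sym eq)
  boundary (suc k) eq = J.near-perfect-matching J.transitive
    (J.connected inside k d refl refl (ℕₚ.m≤n⇒m≤1+n (s≤s (ℕₚ.m≤m+n k d)))
      (ℕₚ.≤-reflexive (trans (both k d) eq)))
    where module J = Johnson n (suc (suc k + d)) (suc k)

  case : suc (k + d) + suc d < n ⊎ suc (k + d) + suc d ≡ n → ∃ λ M → exposed M ≤ 1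
  case (inj₂ eq)   = boundary k eq
  case (inj₁ less) = near-perfect-matching transitive
    (connected outside k (suc d) refl (ℕₚ.+-suc k d) (s≤s (ℕₚ.m≤m+n k d))
      (subst (_≤ n) (neither k d) less))

johnson-matching : ∀ {n r k} → k < r → 2 * r ∸ k ≤ n → (let open Johnson n r k) →
  ∃ λ M → exposed M ≤ 1
johnson-matching {n} {r} {k} k<r 2r-k≤n with d , refl ← ℕₚ.m≤n⇒∃[o]m+o≡n k<r =
  johnson-matching′ n k d (subst (_≤ n) union-size 2r-k≤n)
  where
  rearrange : ∀ k d → 2 * suc (k + d) ≡ suc (k + d) + suc d + k
  rearrange = solve-∀

  union-size : 2 * suc (k + d) ∸ k ≡ suc (k + d) + suc d
  union-size = trans (cong (_∸ k) (rearrange k d)) (ℕₚ.m+n∸n≡m (suc (k + d) + suc d) k)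

-- Injections of labelled vertex sets and copies of H.

module Embedding {T : Set} (_≟_ : DecidableEquality T) where

  # : T → {n : ℕ} → Vec T n → ℕ
  # t = count (_≟ t)

  lookup-remove : ∀ {n} (d : Vec T (suc n)) p x → lookup (removeAt d p) x ≡ lookup d (punchIn p x)
  lookup-remove (y ∷ d)     zero    x       = refl
  lookup-remove (y ∷ z ∷ d) (suc p) zero    = refl
  lookup-remove (y ∷ z ∷ d) (suc p) (suc x) = lookup-remove (z ∷ d) p x

  #-remove : ∀ {n} (d : Vec T (suc n)) p t →
    # t d ≡ # t (lookup d p ∷ removeAt d p)
  #-remove (y ∷ d)     zero    t = refl
  #-remove (y ∷ z ∷ d) (suc p) t
    with ih ← #-remove (z ∷ d) p t
    with lookup (z ∷ d) p ≟ t | y ≟ t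
  ... | yes _ | yes _ = cong suc ih
  ... | yes _ | no  _ = ih
  ... | no  _ | yes _ = cong suc ih
  ... | no  _ | no  _ = ih

  #-self : ∀ t {n} (d : Vec T n) → # t (t ∷ d) ≡ suc (# t d)
  #-self t d rewrite dec-true (t ≟ t) refl = refl

  find : ∀ t {n} (d : Vec T n) → 1 ≤ # t d → ∃ λ p → lookup d p ≡ t
  find t (y ∷ d) 1≤ with y ≟ t
  ... | yes y≡t = zero , y≡t
  ... | no  _   with p , eq ← find t d 1≤ = suc p , eq

  lookup⇒# : ∀ {n} (d : Vec T n) y → 1 ≤ # (lookup d y) d
  lookup⇒# (x ∷ d) zero rewrite dec-true (x ≟ x) refl = s≤s z≤n
  lookup⇒# (x ∷ d) (suc y) with x ≟ lookup d y
  ... | yes _ = s≤s z≤n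
  ... | no  _ = lookup⇒# d y

  #-∷-cancel-≤ : ∀ x {m n} (c : Vec T m) (d : Vec T n) t → # t (x ∷ c) ≤ # t (x ∷ d) → # t c ≤ # t d
  #-∷-cancel-≤ x c d t le with x ≟ t
  ... | yes _ = ℕₚ.≤-pred le
  ... | no  _ = le

  #-∷-cancel-≡ : ∀ x {m n} (c : Vec T m) (d : Vec T n) t → # t (x ∷ c) ≡ # t (x ∷ d) → # t c ≡ # t d
  #-∷-cancel-≡ x c d t eq with x ≟ t
  ... | yes _ = ℕₚ.suc-injective eq
  ... | no  _ = eq

  -- `onto` is what makes the image of an edge a whole edge and not just a subset of it: a label
  -- equally frequent on both sides is hit at all its positions.
  record Embedding {m n} (c : Vec T m) (d : Vec T n) : Set where
    field
      embed     : Fin m → Fin n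
      injective : Injective _≡_ _≡_ embed
      labels    : ∀ x → lookup d (embed x) ≡ lookup c x
      onto      : ∀ y → # (lookup d y) c ≡ # (lookup d y) d → ∃ λ x → embed x ≡ y

  -- Send the first vertex to some position with its label and delete that position; the label
  -- counts stay comparable.
  embedding : ∀ {m n} (c : Vec T m) (d : Vec T n) → (∀ t → # t c ≤ # t d) → Embedding c d
  embedding [] d _ = record
    { embed     = λ ()
    ; injective = λ { {()} }
    ; labels    = λ ()
    ; onto      = λ y eq → contradiction (subst (1 ≤_) (sym eq) (lookup⇒# d y)) λ ()
    }
  embedding {suc m} (t ∷ c) d c≤d
    with find t d (ℕₚ.≤-trans (subst (1 ≤_) (sym (#-self t c)) (s≤s z≤n)) (c≤d t))
  embedding {suc m} {suc n} (t ∷ c) d c≤d | p , refl = record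
    { embed     = embed′
    ; injective = λ {x} {y} → injective′ x y
    ; labels    = λ { zero    → refl
                    ; (suc x) → trans (sym (lookup-remove d p (E.embed x))) (E.labels x) }
    ; onto      = onto′
    }
    where
    d′ = removeAt d p

    module E = Embedding (embedding c d′ λ s →
      #-∷-cancel-≤ t c d′ s (subst (# s (t ∷ c) ≤_) (#-remove d p s) (c≤d s)))

    embed′ : Fin (suc m) → Fin (suc n)
    embed′ zero    = p
    embed′ (suc x) = punchIn p (E.embed x)

    injective′ : ∀ x y → embed′ x ≡ embed′ y → x ≡ y
    injective′ zero    zero    eq = refl
    injective′ zero    (suc y) eq = contradiction (sym eq) (punchInᵢ≢i p _)
    injective′ (suc x) zero    eq = contradiction eq (punchInᵢ≢i p _)
    injective′ (suc x) (suc y) eq = cong suc (E.injective (punchIn-injective p _ _ eq))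

    onto′ : ∀ y → # (lookup d y) (t ∷ c) ≡ # (lookup d y) d → ∃ λ x → embed′ x ≡ y
    onto′ y eq with p Fin.≟ y
    ... | yes refl = zero , refl
    ... | no  p≢y  = suc (proj₁ rest) , trans (cong (punchIn p) (proj₂ rest)) (punchIn-punchOut p≢y)
      where
      z = punchOut p≢y
      label-z : lookup d′ z ≡ lookup d y
      label-z = trans (lookup-remove d p z) (cong (lookup d) (punchIn-punchOut p≢y))
      rest : ∃ λ x → E.embed x ≡ z
      rest = E.onto z (subst (λ s → # s c ≡ # s d′) (sym label-z)
        (#-∷-cancel-≡ t c d′ _ (trans eq (#-remove d p _))))

-- A vertex is labelled by its membership in the two edges, that is, by its region of their Venn
-- diagram.
Label : Set
Label = Bool × Bool

open Embedding (Product.≡-dec Bool._≟_ Bool._≟_)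

#-∩ : ∀ {n} (a b : Subset n) → # (inside , inside) (zip a b) ≡ ∣ a ∩ b ∣
#-∩ []            []            = refl
#-∩ (inside  ∷ a) (inside  ∷ b) = cong suc (#-∩ a b)
#-∩ (inside  ∷ a) (outside ∷ b) = #-∩ a b
#-∩ (outside ∷ a) (inside  ∷ b) = #-∩ a b
#-∩ (outside ∷ a) (outside ∷ b) = #-∩ a b

#-left : ∀ {n} (a b : Subset n) → # (inside , outside) (zip a b) + ∣ a ∩ b ∣ ≡ ∣ a ∣
#-left []            []            = refl
#-left (inside  ∷ a) (inside  ∷ b) = trans (ℕₚ.+-suc _ _) (cong suc (#-left a b))
#-left (inside  ∷ a) (outside ∷ b) = cong suc (#-left a b)
#-left (outside ∷ a) (inside  ∷ b) = #-left a b
#-left (outside ∷ a) (outside ∷ b) = #-left a b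

#-right : ∀ {n} (a b : Subset n) → # (outside , inside) (zip a b) + ∣ a ∩ b ∣ ≡ ∣ b ∣
#-right []            []            = refl
#-right (inside  ∷ a) (inside  ∷ b) = trans (ℕₚ.+-suc _ _) (cong suc (#-right a b))
#-right (inside  ∷ a) (outside ∷ b) = #-right a b
#-right (outside ∷ a) (inside  ∷ b) = cong suc (#-right a b)
#-right (outside ∷ a) (outside ∷ b) = #-right a b

#-neither : ∀ {n} (a b : Subset n) → (∀ x → (x ∈ a) ⊎ (x ∈ b)) → # (outside , outside) (zip a b) ≡ 0
#-neither a b cover = ℕₚ.n<1⇒n≡0 (ℕₚ.≰⇒> none)
  where
  none : ¬ (1 ≤ # (outside , outside) (zip a b))
  none 1≤ with x , eq ← find _ (zip a b) 1≤
    with lookup-zip x a b | cover x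
  ... | eq′ | inj₁ x∈a =
    contradiction (trans (sym ([]=⇒lookup x∈a)) (cong proj₁ (trans (sym eq′) eq))) λ ()
  ... | eq′ | inj₂ x∈b =
    contradiction (trans (sym ([]=⇒lookup x∈b)) (cong proj₂ (trans (sym eq′) eq))) λ ()

-- The three sizes determine the three regions that meet an edge. The fourth region is empty in the
-- source, by `cover`, so its size in the target is irrelevant.
pair-embedding : ∀ {m n} (a b : Subset m) (e f : Subset n) → (∀ x → (x ∈ a) ⊎ (x ∈ b)) →
  ∣ a ∣ ≡ ∣ e ∣ → ∣ b ∣ ≡ ∣ f ∣ → ∣ a ∩ b ∣ ≡ ∣ e ∩ f ∣ →
  Σ (Fin m → Fin n) λ φ → Injective _≡_ _≡_ φ × IsImage φ a e × IsImage φ b f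
pair-embedding {m} {n} a b e f cover ∣a∣ ∣b∣ ∣a∩b∣ =
  embed , injective , 
  image proj₁ a e (left a b) (left e f) (λ { _ refl () }) ,
  image proj₂ b f (right a b) (right e f) (λ { _ refl () })
  where
  same : ∀ t → t ≢ (outside , outside) → # t (zip a b) ≡ # t (zip e f)
  same (inside , inside)   _ = trans (#-∩ a b) (trans ∣a∩b∣ (sym (#-∩ e f)))
  same (inside , outside)  _ = ℕₚ.+-cancelʳ-≡ ∣ e ∩ f ∣ _ _
    (trans (cong (_ +_) (sym ∣a∩b∣)) (trans (#-left a b) (trans ∣a∣ (sym (#-left e f)))))
  same (outside , inside)  _ = ℕₚ.+-cancelʳ-≡ ∣ e ∩ f ∣ _ _
    (trans (cong (_ +_) (sym ∣a∩b∣)) (trans (#-right a b) (trans ∣b∣ (sym (#-right e f)))))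
  same (outside , outside) ≢ = contradiction refl ≢

  bound : ∀ t → # t (zip a b) ≤ # t (zip e f)
  bound (outside , outside) = subst (_≤ _) (sym (#-neither a b cover)) z≤n
  bound (inside , inside)   = ℕₚ.≤-reflexive (same _ λ ())
  bound (inside , outside)  = ℕₚ.≤-reflexive (same _ λ ())
  bound (outside , inside)  = ℕₚ.≤-reflexive (same _ λ ())

  open Embedding.Embedding (embedding (zip a b) (zip e f) bound)

  left : ∀ {k} (p q : Subset k) x → proj₁ (lookup (zip p q) x) ≡ lookup p x
  left p q x = cong proj₁ (lookup-zip x p q)

  right : ∀ {k} (p q : Subset k) x → proj₂ (lookup (zip p q) x) ≡ lookup q x
  right p q x = cong proj₂ (lookup-zip x p q)

  -- `g` reads one edge off the labels. It vanishes on the label outside both edges, so every vertex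
  -- of the target edge has a label with equal counts and `onto` applies.
  image : (g : Label → Bool) (h : Subset m) (h′ : Subset n) →
    (∀ x → g (lookup (zip a b) x) ≡ lookup h x) → (∀ y → g (lookup (zip e f) y) ≡ lookup h′ y) →
    (∀ t → t ≡ (outside , outside) → g t ≢ inside) → IsImage embed h h′
  image g h h′ gh gh′ g-out y = mk⇔ preimage λ { (x , x∈h , refl) →
      lookup⇒[]= (embed x) h′ (trans (sym (gh′ (embed x)))
        (trans (cong g (labels x)) (trans (gh x) ([]=⇒lookup x∈h)))) }
    where
    preimage : y ∈ h′ → ∃ λ x → x ∈ h × embed x ≡ y
    preimage y∈h′ with x , refl ← onto y (same _ λ eq →
                      g-out _ eq (trans (gh′ y) ([]=⇒lookup y∈h′))) =
      x , lookup⇒[]= x h (trans (sym (gh x)) (trans (cong g (sym (labels x)))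
            (trans (gh′ (embed x)) ([]=⇒lookup y∈h′)))) , refl

image-unique : ∀ {m n} {φ : Fin m → Fin n} {h : Subset m} {e e′ : Subset n} →
  IsImage φ h e → IsImage φ h e′ → e ≡ e′
image-unique im im′ = ⊆-antisym
  (λ {y} y∈ → Equivalence.from (im′ y) (Equivalence.to (im y) y∈))
  (λ {y} y∈ → Equivalence.from (im y) (Equivalence.to (im′ y) y∈))

-- Parts of a decomposition when H has two edges.

Matched : ∀ {n} → ℕ → ℕ → List (Subset n) → Set
Matched r k P = (∃ λ e → P ≡ e ∷ []) ⊎
  (∃ λ e → ∃ λ f → P ≡ e ∷ f ∷ [] × ∣ e ∣ ≡ r × ∣ f ∣ ≡ r × ∣ e ∩ f ∣ ≡ k)

module TwoEdges {r m : ℕ} (H : RGraph r m) {a b : Subset m} (H≡ : edges H ≡ a ∷ b ∷ []) where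

  private
    sizes : All (λ e → ∣ e ∣ ≡ r) (a ∷ b ∷ [])
    sizes = subst (All _) H≡ (uniform H)

  matched⇒part : ∀ {n k} {P : List (Subset n)} → (∀ x → (x ∈ a) ⊎ (x ∈ b)) → ∣ a ∩ b ∣ ≡ k →
    Matched r k P → IsPart H P
  matched⇒part cover ∣a∩b∣ (inj₁ single) = inj₁ single
  matched⇒part cover ∣a∩b∣ (inj₂ (e , f , refl , ∣e∣ , ∣f∣ , ∣e∩f∣))
    with sa ∷ sb ∷ [] ← sizes
    with φ , φ-injective , a↦e , b↦f ← pair-embedding a b e f cover (trans sa (sym ∣e∣))
           (trans sb (sym ∣f∣)) (trans ∣a∩b∣ (sym ∣e∩f∣))
    = inj₂ (φ , φ-injective , λ e′ → mk⇔ to from)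
    where
    to : ∀ {e′} → e′ ∈ₗ e ∷ f ∷ [] → ∃ λ h → h ∈ₗ edges H × IsImage φ h e′
    to (here refl)         = a , subst (a ∈ₗ_) (sym H≡) (here refl) , a↦e
    to (there (here refl)) = b , subst (b ∈ₗ_) (sym H≡) (there (here refl)) , b↦f

    from : ∀ {e′} → (∃ λ h → h ∈ₗ edges H × IsImage φ h e′) → e′ ∈ₗ e ∷ f ∷ []
    from (h , h∈ , h↦e′) with subst (h ∈ₗ_) H≡ h∈
    ... | here refl         = here (image-unique h↦e′ a↦e)
    ... | there (here refl) = there (here (image-unique h↦e′ b↦f))

  -- A copy of H is specified only as a set of edges, so repetitions are excluded by uniqueness.
  -- Among three distinct edges two would be images of the same edge of H, hence equal.
  part-length : ∀ {n} (P Q : List (Subset n)) → Unique (P ++ Q) → IsPart H P → length P ≤ 2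
  part-length _ _ _ (inj₁ (_ , refl)) = s≤s z≤n
  part-length []          _ _ _ = z≤n
  part-length (_ ∷ [])    _ _ _ = s≤s z≤n
  part-length (_ ∷ _ ∷ []) _ _ _ = s≤s (s≤s z≤n)
  part-length (x ∷ y ∷ z ∷ P) Q ((x≢y ∷ x≢z ∷ _) ∷ (y≢z ∷ _) ∷ _) (inj₂ (φ , _ , spec)) =
    contradiction (pigeon (image-of (here refl)) (image-of (there (here refl)))
                          (image-of (there (there (here refl))))) λ ()
    where
    image-of : ∀ {e} → e ∈ₗ x ∷ y ∷ z ∷ P → IsImage φ a e ⊎ IsImage φ b e
    image-of {e} e∈ with h , h∈ , h↦e ← Equivalence.to (spec e) e∈ | subst (h ∈ₗ_) H≡ h∈
    ... | here refl         = inj₁ h↦e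
    ... | there (here refl) = inj₂ h↦e

    pigeon : IsImage φ a x ⊎ IsImage φ b x → IsImage φ a y ⊎ IsImage φ b y →
      IsImage φ a z ⊎ IsImage φ b z → 1 ≤ 0
    pigeon (inj₁ p) (inj₁ q) _        = contradiction (image-unique p q) x≢y
    pigeon (inj₂ p) (inj₂ q) _        = contradiction (image-unique p q) x≢y
    pigeon (inj₁ p) (inj₂ q) (inj₁ s) = contradiction (image-unique p s) x≢z
    pigeon (inj₁ p) (inj₂ q) (inj₂ s) = contradiction (image-unique q s) y≢z
    pigeon (inj₂ p) (inj₁ q) (inj₁ s) = contradiction (image-unique q s) y≢z
    pigeon (inj₂ p) (inj₁ q) (inj₂ s) = contradiction (image-unique p s) x≢z

  concat-length : ∀ {n} (Ps : List (List (Subset n))) → Unique (concat Ps) → All (IsPart H) Ps →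
    length (concat Ps) ≤ length Ps + length Ps
  concat-length []       _  _        = z≤n
  concat-length (P ∷ Ps) u (p ∷ ps) = begin
    length (P ++ concat Ps)             ≡⟨ length-++ P ⟩
    length P + length (concat Ps)       ≤⟨ ℕₚ.+-mono-≤ (part-length P (concat Ps) u p)
                                             (concat-length Ps (drop-prefix P u) ps) ⟩
    2 + (length Ps + length Ps)         ≡⟨ cong suc (ℕₚ.+-suc (length Ps) (length Ps)) ⟨
    suc (length Ps) + suc (length Ps)   ∎
    where
    open ≤-Reasoning
    drop-prefix : ∀ {A : Set} (xs : List A) {ys} → Unique (xs ++ ys) → Unique ys
    drop-prefix []       u       = u
    drop-prefix (x ∷ xs) (_ ∷ u) = drop-prefix xs u

  half-edges≤parts : ∀ {n} {G : RGraph r n} (D : Decomposition H G) →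
    ⌈ length (edges G) /2⌉ ≤ length (parts D)
  half-edges≤parts {G = G} D = begin
    ⌈ length (edges G) /2⌉                         ≡⟨ cong ⌈_/2⌉ (Perm.↭-length (partition D)) ⟨
    ⌈ length (concat (parts D)) /2⌉                ≤⟨ ℕₚ.⌈n/2⌉-mono
                                                         (concat-length (parts D) parts! (allParts D)) ⟩
    ⌈ length (parts D) + length (parts D) /2⌉      ≡⟨ ℕₚ.n≡⌈n+n/2⌉ (length (parts D)) ⟨
    length (parts D)                               ∎
    where
    open ≤-Reasoning
    parts! : Unique (concat (parts D))
    parts! = PermSetoid.Unique-resp-↭ (setoid _) (↭⇒↭ₛ (↭-sym (partition D))) (unique G)

-- Restricting a partition to a subgraph.

module Restriction {n r k : ℕ} {Q : Subset n → Set} (Q? : ∀ e → Dec (Q e)) where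

  -- A pair that loses an edge becomes a singleton. A part that loses all its edges must be dropped,
  -- as an empty list is not a part.
  restrict-part : ∀ P → Matched r k P → filter Q? P ≡ [] ⊎ Matched r k (filter Q? P)
  restrict-part _ (inj₁ (e , refl)) with Q? e
  ... | yes _ = inj₂ (inj₁ (e , refl))
  ... | no  _ = inj₁ refl
  restrict-part _ (inj₂ (e , f , refl , sizes)) with Q? e
  ... | yes _ with Q? f
  ...   | yes _ = inj₂ (inj₂ (e , f , refl , sizes))
  ...   | no  _ = inj₂ (inj₁ (e , refl))
  restrict-part _ (inj₂ (e , f , refl , sizes)) | no _ with Q? f
  ...   | yes _ = inj₂ (inj₁ (f , refl))
  ...   | no  _ = inj₁ refl

  restrict : ∀ Ps → All (Matched r k) Ps →
    ∃ λ Ps′ → concat Ps′ ≡ filter Q? (concat Ps) × All (Matched r k) Ps′ × length Ps′ ≤ length Ps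
  restrict []       []       = [] , refl , [] , z≤n
  restrict (P ∷ Ps) (p ∷ ps)
    with Ps′ , concat≡ , ps′ , le ← restrict Ps ps
    with eq ← trans (cong (filter Q? P ++_) concat≡) (sym (filter-++ Q? P (concat Ps)))
    with restrict-part P p
  ... | inj₁ empty = Ps′ , trans (cong (_++ concat Ps′) (sym empty)) eq , ps′ , ℕₚ.m≤n⇒m≤1+n le
  ... | inj₂ p′    = filter Q? P ∷ Ps′ , eq , p′ ∷ ps′ , s≤s le

-- The complete graph and the values of φ.

all-subsets : ∀ n r → List (Subset n)
all-subsets n r = map proj₁ (ksubsets n r)

complete-graph : ∀ n r → RGraph r n
complete-graph n r = record
  { edges   = all-subsets n r
  ; unique  = Uniq.map⁺ KSubset-≡ (ksubsets! n r)
  ; uniform = All.map⁺ (All.tabulate λ {u} _ → proj₂ u)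
  }

∈-all-subsets : ∀ {n r} (e : Subset n) → ∣ e ∣ ≡ r → e ∈ₗ all-subsets n r
∈-all-subsets {n} {r} e ∣e∣ = ∈-map⁺ proj₁ (ksubsets-complete n r (e , ∣e∣))

length-all-subsets : ∀ n r → length (all-subsets n r) ≡ n C r
length-all-subsets n r = trans (length-map proj₁ (ksubsets n r)) (length-ksubsets n r)

complete-length : ∀ {n r} (G : RGraph r n) → IsComplete G → length (edges G) ≡ n C r
complete-length {n} {r} G complete = trans
  (Perm.↭-length (unique-set⇒↭ (unique G) (unique (complete-graph n r))
    (λ {e} e∈ → ∈-all-subsets e (All.lookup (uniform G) e∈))
    (λ e∈ → complete _ (All.lookup (uniform (complete-graph n r)) e∈))))
  (length-all-subsets n r)

matched-partition : ∀ {n r k} → k < r → 2 * r ∸ k ≤ n →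
  ∃ λ Ps → concat Ps ↭ all-subsets n r × All (Matched r k) Ps × length Ps ≤ ⌈ (n C r) /2⌉
matched-partition {n} {r} {k} k<r 2r-k≤n
  with M , ≤1 ← johnson-matching k<r 2r-k≤n
  with Ps , concat↭ , ps , len ← Johnson.pairing n r k M
  = map (map proj₁) Ps
  , subst (_↭ all-subsets n r) (sym (concat-map Ps)) (Perm.map⁺ proj₁ concat↭)
  , All.map⁺ (All.map matched ps)
  , subst (_≤ ⌈ (n C r) /2⌉) (sym (length-map (map proj₁) Ps)) (begin
      -- Twice the number of parts is the number of vertices plus that of exposed ones, so at most
      -- C(n,r) + 1; halving and rounding down gives the ceiling.
      length Ps                        ≡⟨ ℕₚ.n≡⌊n+n/2⌋ (length Ps) ⟩
      ⌊ length Ps + length Ps /2⌋      ≡⟨ cong ⌊_/2⌋ len ⟩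
      ⌊ length (ksubsets n r) + Johnson.exposed n r k M /2⌋  ≤⟨ ℕₚ.⌊n/2⌋-mono (ℕₚ.+-monoʳ-≤ _ ≤1) ⟩
      ⌊ length (ksubsets n r) + 1 /2⌋  ≡⟨ cong ⌊_/2⌋ (ℕₚ.+-comm _ 1) ⟩
      ⌈ length (ksubsets n r) /2⌉      ≡⟨ cong ⌈_/2⌉ (length-ksubsets n r) ⟩
      ⌈ (n C r) /2⌉                    ∎)
  where
  open ≤-Reasoning
  matched : ∀ {P} → Johnson.Part n r k P → Matched r k (map proj₁ P)
  matched (inj₁ (u , refl))           = inj₁ (proj₁ u , refl)
  matched (inj₂ (u , v , refl , u–v)) = inj₂ (proj₁ u , proj₁ v , refl , proj₂ u , proj₂ v , u–v)

theorem1p1 : (r k : ℕ) → 2 ≤ r → k ≤ r ∸ 1 →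
    (m : ℕ) (H : RGraph r m) (a b : Subset m) →
    edges H ≡ a ∷ b ∷ [] → ∣ a ∩ b ∣ ≡ k →
    (∀ (x : Fin m) → (x ∈ a) ⊎ (x ∈ b)) →
    (n : ℕ) → 2 * r ∸ k ≤ n →
    IsPhiN H n ⌈ (n C r) /2⌉ ×
    (∀ (G : RGraph r n) → InK 2 G → Extremal H G) ×
    ((n C r) % 2 ≡ 0 → ∀ (G : RGraph r n) → IsComplete G → Extremal H G)
theorem1p1 r@(suc _) k (s≤s _) k≤r-1 m H a b H≡ ∣a∩b∣ cover n 2r-k≤n =
  phiN , (λ G inK → t , phiN , phi G (inK⇒half G inK)) ,
  (λ _ G complete → t , phiN , phi G (cong ⌈_/2⌉ (complete-length G complete)))
  where
  open TwoEdges H H≡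
  open DecMembership (≡-dec {n = n} Bool._≟_) using (_∈?_)

  t : ℕ
  t = ⌈ (n C r) /2⌉

  decompose : ∀ (G : RGraph r n) → Σ (Decomposition H G) λ D → length (parts D) ≤ t
  decompose G
    with Ps , concat↭ , ps , ≤t ← matched-partition (s≤s k≤r-1) 2r-k≤n
    with Ps′ , concat≡ , ps′ , le ← Restriction.restrict (_∈? edges G) Ps ps
    = record
        { parts     = Ps′
        ; partition = subst (_↭ edges G) (sym concat≡)
                        (↭-trans (Perm.filter-↭ (_∈? edges G) concat↭) filter↭)
        ; allParts  = All.map (matched⇒part cover ∣a∩b∣) ps′
        } , ℕₚ.≤-trans le ≤t
    where
    filter↭ : filter (_∈? edges G) (all-subsets n r) ↭ edges G
    filter↭ = unique-set⇒↭ (Uniq.filter⁺ (_∈? edges G) (unique (complete-graph n r))) (unique G)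
      (λ e∈ → proj₂ (∈-filter⁻ (_∈? edges G) {xs = all-subsets n r} e∈))
      (λ {e} e∈ → ∈-filter⁺ (_∈? edges G) (∈-all-subsets e (All.lookup (uniform G) e∈)) e∈)

  -- The upper bound `t` holds for every graph, and the lower bound depends on the number of edges
  -- alone; attaining `t` is thus a matter of counting edges.
  phi : ∀ G → ⌈ length (edges G) /2⌉ ≡ t → IsPhi H G t
  phi G half≡t with D , ≤t ← decompose G =
    (D , ℕₚ.≤-antisym ≤t (bound D)) , bound
    where
    bound : ∀ (D : Decomposition H G) → t ≤ length (parts D)
    bound D = subst (_≤ length (parts D)) half≡t (half-edges≤parts D)

  phiN : IsPhiN H n t
  phiN = (complete-graph n r , phi (complete-graph n r) (cong ⌈_/2⌉ (length-all-subsets n r))) ,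
    λ { G s (_ , minimal) → ℕₚ.≤-trans (minimal (proj₁ (decompose G))) (proj₂ (decompose G)) }

  even-half : ∀ j → suc j % 2 ≡ 0 → ⌈ j /2⌉ ≡ ⌈ suc j /2⌉
  even-half (suc zero)    _  = refl
  even-half (suc (suc j)) eq = cong suc (even-half j eq)

  -- For modulus 2 at most one edge is deleted, and only from an even total, where the ceiling of
  -- the half does not change.
  inK⇒half : ∀ (G : RGraph r n) → InK 2 G → ⌈ length (edges G) /2⌉ ≡ t
  inK⇒half G (zero    , _ , _      , size) = cong ⌈_/2⌉ (trans (sym (ℕₚ.+-identityʳ _)) size)
  inK⇒half G (suc zero , _ , parity , size) = trans
    (even-half (length (edges G)) (trans (cong (_% 2) size′) parity)) (cong ⌈_/2⌉ size′)
    where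
    size′ : suc (length (edges G)) ≡ n C r
    size′ = trans (ℕₚ.+-comm 1 _) size
  inK⇒half G (suc (suc _) , s≤s (s≤s ()) , _)
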